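{- For every constant $c>0$ there exists $n_0$ such that for all $n\ge n_0$ the following holds. Let $G$ be a graph of order $n$ with minimum degree $\delta(G)\ge (3/4+c)n$. Then $\mathcal{D}(G,\mathcal{H})\ge cn/32$; that is, for every labeling $f:E(G)\to\{ -1,1\}$ there is a Hamilton cycle $H$ of $G$ with $\left|\sum_{e\in E(H)} f(e)\right|\ge cn/32$.
   Context: All graphs are finite and simple. For a graph $G$, a family $\mathcal{S}_G$ of subgraphs of $G$ and a labeling $f:E(G)\to\{ -1,1\}$, put $f(S)=\sum_{e\in E(S)}f(e)$ for $S\in\mathcal{S}_G$. The discrepancy is $\mathcal{D}(G,\mathcal{S}_G)=\min_{f}\max_{S\in\mathcal{S}_G}|f(S)|$, the minimum being over all $f:E(G)\to\{ -1,1\}$. Here $\mathcal{H}$ is the set of Hamilton cycles of $G$. -}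

module Defs where

open import Data.Nat as ℕ using (ℕ; suc; _⊔_)
import Data.Nat.Properties as ℕₚ
open import Data.Nat.DivMod using (_mod_)
open import Data.Integer as ℤ using (ℤ; +_; _◃_)
open import Data.Rational as ℚ using (ℚ; 0ℚ; 1ℚ; ½)
import Data.Rational.Properties as ℚₚ
open import Data.Rational.Solver using (module +-*-Solver)
open import Data.Sign using (Sign)
open import Data.Fin as Fin using (Fin; toℕ)
import Data.Fin.Properties as Finₚ
open import Data.Fin.Permutation using (Permutation′; _⟨$⟩ʳ_)
open import Data.Fin.Subset using (Subset; ∣_∣)
open import Data.List using (List; map; foldr; allFin)
open import Data.List.Extrema.Nat using (min)
open import Data.Vec using (tabulate)
open import Data.Product using (∃-syntax; _×_; _,_; proj₁; proj₂)
open import Data.Empty using (⊥-elim)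
open import Level using (0ℓ)
open import Relation.Binary using (Rel; Decidable; Symmetric; Irreflexive; tri<; tri≈; tri>)
open import Relation.Binary.PropositionalEquality
  using (_≡_; refl; sym; cong; subst)
open import Relation.Nullary using (does)

------------------------------------------------------------------------
-- Real numbers as Cauchy sequences of rationals.  Equality of reals is
-- not _≡_; the orders below are the ones induced on equivalence classes.

record ℝ : Set where
  field
    seq    : ℕ → ℚ
    cauchy : ∀ ε → 0ℚ ℚ.< ε → ∃[ N ] ∀ m k → N ℕ.≤ m → N ℕ.≤ k →
             ℚ.∣ seq m ℚ.- seq k ∣ ℚ.< ε

open ℝ public

infix  4 _≤ℝ_ _<ℝ_
infixl 6 _+ℝ_
infixr 7 _*ₗ_

_≤ℝ_ : ℝ → ℝ → Set
x ≤ℝ y = ∀ ε → 0ℚ ℚ.< ε → ∃[ N ] ∀ m → N ℕ.≤ m → seq x m ℚ.≤ seq y m ℚ.+ ε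

_<ℝ_ : ℝ → ℝ → Set
x <ℝ y = ∃[ ε ] 0ℚ ℚ.< ε × ∃[ N ] ∀ m → N ℕ.≤ m → seq x m ℚ.+ ε ℚ.≤ seq y m

fromℚ : ℚ → ℝ
fromℚ q .seq    _       = q
fromℚ q .cauchy ε 0<ε = 0 , λ _ _ _ _ →
  subst (λ r → ℚ.∣ r ∣ ℚ.< ε) (sym (ℚₚ.+-inverseʳ q)) 0<ε

fromℕ : ℕ → ℝ
fromℕ n = fromℚ (+ n ℚ./ 1)

_+ℝ_ : ℝ → ℝ → ℝ
(x +ℝ y) .seq m = seq x m ℚ.+ seq y m
(x +ℝ y) .cauchy ε 0<ε = N ⊔ M , λ m k N⊔M≤m N⊔M≤k → begin-strict
  ℚ.∣ (seq x m ℚ.+ seq y m) ℚ.- (seq x k ℚ.+ seq y k) ∣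
    ≡⟨ cong ℚ.∣_∣ (interchange (seq x m) (seq y m) (seq x k) (seq y k)) ⟩
  ℚ.∣ (seq x m ℚ.- seq x k) ℚ.+ (seq y m ℚ.- seq y k) ∣
    ≤⟨ ℚₚ.∣p+q∣≤∣p∣+∣q∣ (seq x m ℚ.- seq x k) (seq y m ℚ.- seq y k) ⟩
  ℚ.∣ seq x m ℚ.- seq x k ∣ ℚ.+ ℚ.∣ seq y m ℚ.- seq y k ∣
    <⟨ ℚₚ.+-mono-< (x-close m k (ℕₚ.m⊔n≤o⇒m≤o N M N⊔M≤m) (ℕₚ.m⊔n≤o⇒m≤o N M N⊔M≤k))
                   (y-close m k (ℕₚ.m⊔n≤o⇒n≤o N M N⊔M≤m) (ℕₚ.m⊔n≤o⇒n≤o N M N⊔M≤k)) ⟩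
  ½ ℚ.* ε ℚ.+ ½ ℚ.* ε
    ≡⟨ sym (ℚₚ.*-distribʳ-+ ε ½ ½) ⟩
  1ℚ ℚ.* ε
    ≡⟨ ℚₚ.*-identityˡ ε ⟩
  ε ∎
  where
  open ℚₚ.≤-Reasoning

  interchange : ∀ a b c d → (a ℚ.+ b) ℚ.- (c ℚ.+ d) ≡ (a ℚ.- c) ℚ.+ (b ℚ.- d)
  interchange = solve 4 (λ a b c d → (a :+ b) :- (c :+ d) := (a :- c) :+ (b :- d)) refl
    where open +-*-Solver

  0<½ε : 0ℚ ℚ.< ½ ℚ.* ε
  0<½ε = subst (ℚ._< ½ ℚ.* ε) (ℚₚ.*-zeroʳ ½) (ℚₚ.*-monoʳ-<-pos ½ 0<ε)

  x-modulus = cauchy x (½ ℚ.* ε) 0<½ε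
  y-modulus = cauchy y (½ ℚ.* ε) 0<½ε
  N = proj₁ x-modulus
  M = proj₁ y-modulus
  x-close = proj₂ x-modulus
  y-close = proj₂ y-modulus

_*ₗ_ : ℚ → ℝ → ℝ
(q *ₗ x) .seq m = q ℚ.* seq x m
(q *ₗ x) .cauchy ε 0<ε = N , λ m k N≤m N≤k → begin-strict
  ℚ.∣ q ℚ.* seq x m ℚ.- q ℚ.* seq x k ∣
    ≡⟨ cong ℚ.∣_∣ (factor q (seq x m) (seq x k)) ⟩
  ℚ.∣ q ℚ.* (seq x m ℚ.- seq x k) ∣
    ≡⟨ ℚₚ.∣p*q∣≡∣p∣*∣q∣ q (seq x m ℚ.- seq x k) ⟩
  ℚ.∣ q ∣ ℚ.* ℚ.∣ seq x m ℚ.- seq x k ∣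
    ≤⟨ ℚₚ.*-monoʳ-≤-nonNeg ℚ.∣ seq x m ℚ.- seq x k ∣
         {{ℚₚ.∣-∣-nonNeg (seq x m ℚ.- seq x k)}} ∣q∣≤b ⟩
  b ℚ.* ℚ.∣ seq x m ℚ.- seq x k ∣
    <⟨ ℚₚ.*-monoʳ-<-pos b (close m k N≤m N≤k) ⟩
  b ℚ.* (ℚ.1/ b ℚ.* ε)
    ≡⟨ sym (ℚₚ.*-assoc b (ℚ.1/ b) ε) ⟩
  (b ℚ.* ℚ.1/ b) ℚ.* ε
    ≡⟨ cong (ℚ._* ε) (ℚₚ.*-inverseʳ b) ⟩
  1ℚ ℚ.* ε
    ≡⟨ ℚₚ.*-identityˡ ε ⟩
  ε ∎
  where
  open ℚₚ.≤-Reasoning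

  factor : ∀ a b c → a ℚ.* b ℚ.- a ℚ.* c ≡ a ℚ.* (b ℚ.- c)
  factor = solve 3 (λ a b c → a :* b :- a :* c := a :* (b :- c)) refl
    where open +-*-Solver

  b = ℚ.∣ q ∣ ℚ.+ 1ℚ

  instance
    b-pos : ℚ.Positive b
    b-pos = ℚₚ.nonNeg+pos⇒pos ℚ.∣ q ∣ {{ℚₚ.∣-∣-nonNeg q}} 1ℚ
    b-nonZero : ℚ.NonZero b
    b-nonZero = ℚₚ.pos⇒nonZero b
    1/b-pos : ℚ.Positive (ℚ.1/ b)
    1/b-pos = ℚₚ.1/pos⇒pos b

  ∣q∣≤b : ℚ.∣ q ∣ ℚ.≤ b
  ∣q∣≤b = subst (ℚ._≤ b) (ℚₚ.+-identityʳ ℚ.∣ q ∣)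
            (ℚₚ.+-monoʳ-≤ ℚ.∣ q ∣ (ℚₚ.<⇒≤ (ℚₚ.positive⁻¹ 1ℚ)))

  0<ε/b : 0ℚ ℚ.< ℚ.1/ b ℚ.* ε
  0<ε/b = subst (ℚ._< ℚ.1/ b ℚ.* ε) (ℚₚ.*-zeroʳ (ℚ.1/ b)) (ℚₚ.*-monoʳ-<-pos (ℚ.1/ b) 0<ε)

  modulus = cauchy x (ℚ.1/ b ℚ.* ε) 0<ε/b
  N = proj₁ modulus
  close = proj₂ modulus

------------------------------------------------------------------------
-- Finite simple graphs with vertex set Fin n

record Graph (n : ℕ) : Set₁ where
  infix 4 _~_ _~?_
  field
    _~_      : Rel (Fin n) 0ℓ
    _~?_     : Decidable _~_
    ~-sym    : Symmetric _~_
    ~-irrefl : Irreflexive _≡_ _~_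

module _ {n : ℕ} (G : Graph n) where
  open Graph G

  neighbourhood : Fin n → Subset n
  neighbourhood v = tabulate (λ u → does (v ~? u))

  degree : Fin n → ℕ
  degree v = ∣ neighbourhood v ∣

  -- All degrees are smaller than n, so the default value n of min is
  -- irrelevant for n ≥ 1.
  minDegree : ℕ
  minDegree = min n (map degree (allFin n))

  -- An edge is an unordered pair of adjacent vertices, stored with its
  -- smaller endpoint first.  The proof fields are irrelevant, so an edge
  -- is determined by its endpoints.
  record Edge : Set where
    constructor mkEdge
    field
      lo hi     : Fin n
      .lo<hi    : lo Fin.< hi
      .adjacent : lo ~ hi

  edge : ∀ {u v} → u ~ v → Edge
  edge {u} {v} u~v with Finₚ.<-cmp u v
  ... | tri< u<v _   _   = mkEdge u v u<v u~v
  ... | tri≈ _   u≡v _   = ⊥-elim (~-irrefl u≡v u~v)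
  ... | tri> _   _   v<u = mkEdge v u v<u (~-sym u~v)

  -- The sign s stands for the label s ◃ 1 ∈ {-1, 1}.
  Labeling : Set
  Labeling = Edge → Sign

  labelSum : Labeling → List Edge → ℤ
  labelSum f es = foldr ℤ._+_ (+ 0) (map (λ e → f e ◃ 1) es)

  -- Here 𝒮 indexes a family of subgraphs, and E S lists the edges of S,
  -- each once.  As there are finitely many labelings and subgraphs,
  -- x ≤ min_f max_S |f(S)| says that every f admits S with x ≤ |f(S)|.
  Discrepancy≥ : {𝒮 : Set} (E : 𝒮 → List Edge) → ℝ → Set
  Discrepancy≥ {𝒮} E x =
    ∀ (f : Labeling) → ∃[ S ] x ≤ℝ fromℕ ℤ.∣ labelSum f (E S) ∣

cyclicSuc : ∀ {n} → Fin n → Fin n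
cyclicSuc {suc m} i = suc (toℕ i) mod suc m

-- A Hamilton cycle is given by a cyclic enumeration of all vertices with
-- consecutive ones adjacent.  Each cycle as a subgraph arises from 2n
-- enumerations; this changes neither its edge set nor the discrepancy.
record HamiltonCycle {n : ℕ} (G : Graph n) : Set where
  open Graph G
  field
    3≤n         : 3 ℕ.≤ n
    vertex      : Permutation′ n
    consecutive : ∀ i → (vertex ⟨$⟩ʳ i) ~ (vertex ⟨$⟩ʳ cyclicSuc i)

-- The n listed edges are distinct because n ≥ 3.
hamiltonEdges : ∀ {n} (G : Graph n) → HamiltonCycle G → List (Edge G)
hamiltonEdges {n} G H = map (λ i → edge G (consecutive i)) (allFin n)
  where open HamiltonCycle H

{-# OPTIONS --safe #-}

-- A switch is a K₄ on a, b, c, d in which the paths a b c d and a c b d have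
-- different sums.  String disjoint switches together greedily, one connecting
-- vertex between consecutive ones.  If about cn/8 of them fit, extend the
-- string to a Hamilton cycle; traversing all switches in the better or in the
-- worse way gives two cycles whose sums differ by so much that one of them has
-- large discrepancy.  If the process stops earlier, the set U of remaining
-- vertices contains no switch.  Since any four vertices have a common neighbour
-- in U, the value f(ab) + f(ac) - f(bc) then depends on a only, and not on the
-- triangle abc in U; calling it 2g(a), one gets f(ab) = g(a) + g(b) on U, and up
-- to a global sign g takes only the values -1/2 and 3/2.  The vertices of value
-- 3/2 are independent, so there are at most n - δ ≤ n/4 - cn of them, and every
-- positive edge in U meets one of them.  Hence in every Hamilton cycle which
-- leaves U only a few times the negative edges prevail by a multiple of cn.
--
-- The Hamilton cycles come from inserting vertices into a path one by one.
-- A vertex can be inserted between two consecutive neighbours, which exist when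
-- the path has more than 2(n - δ) vertices; while it is shorter, two given
-- consecutive vertices have a common neighbour outside the path.

module Submission where

open import Defs
open import Data.Nat as ℕ using (ℕ; zero; suc; _+_; _*_; _∸_; _≤_; _<_; z≤n; s≤s)
open import Data.Nat.Properties as ℕₚ
  using (≤-refl; ≤-trans; ≤-reflexive; m≤m+n; m≤n+m; +-mono-≤; +-monoʳ-≤; *-monoʳ-≤)
open import Data.Nat.DivMod
  using (_%_; m<n⇒m%n≡m; n%n≡0; m≡m%n+[m/n]*n; m%n<n; m≥n⇒m/n>0) renaming (_/_ to _/ₙ_)
open import Data.Nat.ListAction using (sum)
open import Data.Nat.ListAction.Properties using (sum-++; sum-↭)
open import Data.Nat.Solver renaming (module +-*-Solver to ℕ-Solver)
open import Data.Integer as ℤ using (ℤ; +_; _◃_; _⊖_)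
import Data.Integer.Properties as ℤₚ
open import Data.Rational as ℚ using (ℚ; mkℚ; 0ℚ; 1ℚ; _/_; toℚᵘ)
import Data.Rational.Properties as ℚₚ
open import Data.Rational.Solver renaming (module +-*-Solver to ℚ-Solver)
open import Data.Rational.Unnormalised as ℚᵘ using (mkℚᵘ)
import Data.Rational.Unnormalised.Properties as ℚᵘₚ
open import Data.Sign as Sign using (Sign; opposite)
open import Data.Bool using (true; false; if_then_else_)
open import Data.Empty using (⊥-elim)
open import Data.Product using (∃-syntax; _×_; _,_; proj₁; proj₂)
open import Data.Sum using (_⊎_; inj₁; inj₂)
open import Data.Fin as Fin using (Fin; zero; suc; inject₁; cast)
import Data.Fin.Properties as Finₚ
open import Data.Fin.Relation.Unary.Top using (view; ‵fromℕ; ‵inject₁)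
open import Data.Fin.Permutation using (Permutation′; _⟨$⟩ʳ_; cast-id; _∘ₚ_)
open import Data.Fin.Subset using (∣_∣)
open import Data.Vec as Vec using (Vec; []; _∷_)
open import Data.Vec.Relation.Binary.Pointwise.Inductive as Pointwise using (Pointwise; []; _∷_)
open import Data.List
  using (List; []; _∷_; _++_; [_]; length; map; filter; foldr; tabulate; lookup; allFin)
open import Data.List.Properties
  using (length-++; map-++; map-∘; map-tabulate; tabulate-cong; length-tabulate; lookup-tabulate)
open import Data.List.Extrema.Nat using (min≤⊤; min≤xs)
open import Data.List.Relation.Unary.All as All using (All; []; _∷_)
open import Data.List.Relation.Unary.All.Properties using (¬All⇒Any¬)
open import Data.List.Relation.Unary.Any using (Any; here; there; any?)
open import Data.List.Membership.Propositional using (_∈_; find; lose)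
open import Data.List.Membership.Propositional.Properties
  using (∈-filter⁻; ∈-∃++; ∈-map⁺; ∈-allFin)
open import Data.List.Relation.Binary.Permutation.Propositional
  using (_↭_; prep; swap; ↭-refl; ↭-sym; ↭-trans; ↭⇒↭ₛ)
open import Data.List.Relation.Binary.Permutation.Propositional.Properties
  using (map⁺; ↭-length; ++⁺ˡ; ++⁺ʳ; ++⁺; shift; ∈-resp-↭; ++-identityʳ; ++-commutativeMonoid)
open import Data.List.Relation.Binary.Permutation.Homogeneous using (onIndices)
open import Data.List.Relation.Binary.Permutation.Setoid.Properties using (onIndices-lookup)
open import Function using (_∘_; id)
open import Level using (0ℓ)
open import Relation.Binary
  using (Rel; Decidable; Symmetric; Irreflexive; tri<; tri≈; tri>)
open import Relation.Binary.PropositionalEquality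
  using (_≡_; _≢_; refl; sym; trans; cong; cong₂; subst; subst₂; setoid; module ≡-Reasoning)
open import Relation.Nullary using (¬_; Dec; yes; no; does; contradiction)
open import Relation.Nullary.Decidable using (True; toWitness; _×-dec_)
import Algebra.Solver.CommutativeMonoid as CommutativeMonoidSolver
open import Algebra.Properties.CommutativeSemigroup ℕₚ.+-commutativeSemigroup using (interchange)

-- Linear arithmetic: A ≤ B implies x ≤ y as soon as each coefficient of
-- x + B is at most the corresponding one of y + A.
module Linear where

  infixl 6 _⊕_
  infixr 7 _⊛_
  infix  5 _≼_
  infix  4 _⇒_

  data Expr (n : ℕ) : Set where
    var : Fin n → Expr n
    #   : ℕ → Expr n
    _⊕_ : Expr n → Expr n → Expr n
    _⊛_ : ℕ → Expr n → Expr n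

  data Inequality (n : ℕ) : Set where
    _≼_ : Expr n → Expr n → Inequality n

  data Implication (n : ℕ) : Set where
    _⇒_ : Inequality n → Inequality n → Implication n

  ⟦_⟧ : ∀ {n} → Expr n → Vec ℕ n → ℕ
  ⟦ var i ⟧ ρ = Vec.lookup ρ i
  ⟦ # k   ⟧ ρ = k
  ⟦ e ⊕ f ⟧ ρ = ⟦ e ⟧ ρ + ⟦ f ⟧ ρ
  ⟦ k ⊛ e ⟧ ρ = k * ⟦ e ⟧ ρ

  unit : ∀ {n} → Fin n → Vec ℕ n
  unit zero    = 1 ∷ Vec.replicate _ 0
  unit (suc i) = 0 ∷ unit i

  -- Entry 0 is the constant term.
  coefficients : ∀ {n} → Expr n → Vec ℕ (suc n)
  coefficients (var i) = unit (suc i)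
  coefficients (# k)   = k ∷ Vec.replicate _ 0
  coefficients (e ⊕ f) = Vec.zipWith _+_ (coefficients e) (coefficients f)
  coefficients (k ⊛ e) = Vec.map (k *_) (coefficients e)

  dot : ∀ {n} → Vec ℕ n → Vec ℕ n → ℕ
  dot []       []       = 0
  dot (c ∷ cs) (x ∷ xs) = c * x + dot cs xs

  dot-zero : ∀ {n} (xs : Vec ℕ n) → dot (Vec.replicate n 0) xs ≡ 0
  dot-zero []       = refl
  dot-zero (x ∷ xs) = dot-zero xs

  dot-unit : ∀ {n} i (xs : Vec ℕ n) → dot (unit i) xs ≡ Vec.lookup xs i
  dot-unit zero    (x ∷ xs) = trans (cong₂ _+_ (ℕₚ.*-identityˡ x) (dot-zero xs)) (ℕₚ.+-identityʳ x)
  dot-unit (suc i) (x ∷ xs) = dot-unit i xs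

  dot-+ : ∀ {n} (cs ds xs : Vec ℕ n) → dot (Vec.zipWith _+_ cs ds) xs ≡ dot cs xs + dot ds xs
  dot-+ []       []       []       = refl
  dot-+ (c ∷ cs) (d ∷ ds) (x ∷ xs) = trans
    (cong₂ _+_ (ℕₚ.*-distribʳ-+ x c d) (dot-+ cs ds xs))
    (interchange (c * x) (d * x) (dot cs xs) (dot ds xs))

  dot-* : ∀ {n} k (cs xs : Vec ℕ n) → dot (Vec.map (k *_) cs) xs ≡ k * dot cs xs
  dot-* k []       []       = sym (ℕₚ.*-zeroʳ k)
  dot-* k (c ∷ cs) (x ∷ xs) = trans
    (cong₂ _+_ (ℕₚ.*-assoc k c x) (dot-* k cs xs)) (sym (ℕₚ.*-distribˡ-+ k (c * x) _))

  dot-mono : ∀ {n} {cs ds : Vec ℕ n} → Pointwise _≤_ cs ds → ∀ xs → dot cs xs ≤ dot ds xs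
  dot-mono []         []       = z≤n
  dot-mono (c≤d ∷ le) (x ∷ xs) = +-mono-≤ (ℕₚ.*-monoˡ-≤ x c≤d) (dot-mono le xs)

  ⟦⟧-dot : ∀ {n} (e : Expr n) ρ → ⟦ e ⟧ ρ ≡ dot (coefficients e) (1 ∷ ρ)
  ⟦⟧-dot (var i) ρ = sym (dot-unit (suc i) (1 ∷ ρ))
  ⟦⟧-dot (# k)   ρ = sym (trans (cong₂ _+_ (ℕₚ.*-identityʳ k) (dot-zero ρ)) (ℕₚ.+-identityʳ k))
  ⟦⟧-dot (e ⊕ f) ρ = trans (cong₂ _+_ (⟦⟧-dot e ρ) (⟦⟧-dot f ρ))
                           (sym (dot-+ (coefficients e) (coefficients f) (1 ∷ ρ)))
  ⟦⟧-dot (k ⊛ e) ρ = trans (cong (k *_) (⟦⟧-dot e ρ)) (sym (dot-* k (coefficients e) (1 ∷ ρ)))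

  Dominated : ∀ {n} → Implication n → Set
  Dominated (A ≼ B ⇒ x ≼ y) = True (Pointwise.decidable ℕ._≤?_ (coefficients (x ⊕ B)) (coefficients (y ⊕ A)))

  Valid : ∀ {n} → Implication n → Vec ℕ n → Set
  Valid (A ≼ B ⇒ x ≼ y) ρ = ⟦ A ⟧ ρ ≤ ⟦ B ⟧ ρ → ⟦ x ⟧ ρ ≤ ⟦ y ⟧ ρ

  -- Domination gives x + B ≤ y + A, the hypothesis gives y + A ≤ y + B, and B cancels.
  valid : ∀ {n} (I : Implication n) → Dominated I → ∀ ρ → Valid I ρ
  valid (A ≼ B ⇒ x ≼ y) dom ρ A≤B = ℕₚ.+-cancelʳ-≤ (⟦ B ⟧ ρ) _ _ (≤-trans
    (subst₂ _≤_ (sym (⟦⟧-dot (x ⊕ B) ρ)) (sym (⟦⟧-dot (y ⊕ A) ρ)) (dot-mono (toWitness dom) (1 ∷ ρ)))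
    (+-monoʳ-≤ (⟦ y ⟧ ρ) A≤B))

  -- In use, the hypothesis is a sum of known inequalities assembled with `_⊞_` and `_⊡_`, whose
  -- multipliers form the certificate; the function `f` names the entries of `ρ`, and the
  -- coefficients are compared by evaluation.
  linear : ∀ {n} (ρ : Vec ℕ n) (f : Vec (Expr n) n → Implication n) →
           let I = f (Vec.map var (Vec.allFin n)) in {dom : Dominated I} → Valid I ρ
  linear ρ f {dom} = valid _ dom ρ

open Linear using (#; _⊕_; _⊛_; _≼_; _⇒_; linear)

infixr 6 _⊞_
_⊞_ : ∀ {a b c d} → a ≤ b → c ≤ d → a + c ≤ b + d
_⊞_ = +-mono-≤

infixr 7 _⊡_
_⊡_ : ∀ k {a b} → a ≤ b → k * a ≤ k * b
_⊡_ k = *-monoʳ-≤ k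

-- Signs, and small numbers attached to the ends of an edge

weight : Sign → Sign → ℕ
weight Sign.+ Sign.+ = 1
weight Sign.+ Sign.- = 0
weight Sign.- Sign.+ = 0
weight Sign.- Sign.- = 1

weight-opposite : ∀ σ s → weight σ s + weight (opposite σ) s ≡ 1
weight-opposite Sign.+ Sign.+ = refl
weight-opposite Sign.+ Sign.- = refl
weight-opposite Sign.- Sign.+ = refl
weight-opposite Sign.- Sign.- = refl

weight≤1 : ∀ σ s → weight σ s ≤ 1
weight≤1 σ s = ≤-trans (m≤m+n _ _) (≤-reflexive (weight-opposite σ s))

-- Parity of numbers that are known to be at most 3.
Even Odd : ℕ → Set
Even x = x ≡ 0 ⊎ x ≡ 2
Odd  x = x ≡ 1 ⊎ x ≡ 3

even-or-odd : ∀ {x} → x ≤ 3 → Even x ⊎ Odd x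
even-or-odd {0} _ = inj₁ (inj₁ refl)
even-or-odd {1} _ = inj₂ (inj₁ refl)
even-or-odd {2} _ = inj₁ (inj₂ refl)
even-or-odd {3} _ = inj₂ (inj₂ refl)
even-or-odd {suc (suc (suc (suc _)))} (s≤s (s≤s (s≤s ())))

-- In the application `x` and `y` are the values of `η` at the ends of an edge and `p` tells whether
-- the edge is positive. Their sum is even, so parity spreads along edges.
odd-step : ∀ {p x y} → p ≤ 1 → x + y ≡ 2 * p + 2 → Odd x → Odd y
odd-step z≤n       eq   (inj₁ refl) = inj₁ (ℕₚ.suc-injective eq)
odd-step z≤n       ()   (inj₂ refl)
odd-step (s≤s z≤n) eq   (inj₁ refl) = inj₂ (ℕₚ.suc-injective eq)
odd-step (s≤s z≤n) refl (inj₂ refl) = inj₁ refl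

even-step : ∀ {p x y} → y ≤ 3 → p ≤ 1 → x + y ≡ 2 * p + 2 → Even x → Even y
even-step _   z≤n       eq   (inj₁ refl) = inj₂ eq
even-step _   z≤n       refl (inj₂ refl) = inj₁ refl
-- Here `y` would be 4, which the bound 3 excludes.
even-step y≤3 (s≤s z≤n) refl (inj₁ refl) = contradiction y≤3 λ { (s≤s (s≤s (s≤s ()))) }
even-step _   (s≤s z≤n) refl (inj₂ refl) = inj₂ refl

is0 is3 : ℕ → ℕ
is0 0 = 1
is0 _ = 0
is3 3 = 1
is3 _ = 0

is0≤1 : ∀ x → is0 x ≤ 1
is0≤1 zero    = ≤-refl
is0≤1 (suc _) = z≤n

is3≤1 : ∀ x → is3 x ≤ 1
is3≤1 0 = z≤n
is3≤1 1 = z≤n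
is3≤1 2 = z≤n
is3≤1 3 = ≤-refl
is3≤1 (suc (suc (suc (suc _)))) = z≤n

-- The ends of a positive edge have sum 4, so they cannot both have the value 1.
odd-cover : ∀ {p x y} → p ≤ 1 → x + y ≡ 2 * p + 2 → Odd x → Odd y → p ≤ is3 x + is3 y
odd-cover p≤1       eq (inj₂ refl) _           = ≤-trans p≤1 (m≤m+n 1 _)
odd-cover p≤1       eq _           (inj₂ refl) = ≤-trans p≤1 (m≤n+m 1 _)
odd-cover z≤n       eq (inj₁ refl) (inj₁ refl) = z≤n
odd-cover (s≤s z≤n) () (inj₁ refl) (inj₁ refl)

-- The ends of a negative edge have sum 2, so they cannot both have the value 2.
even-cover : ∀ {p p̄ x y} → p + p̄ ≡ 1 → x + y ≡ 2 * p + 2 → Even x → Even y → p̄ ≤ is0 x + is0 y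
even-cover {p} p+p̄ eq (inj₁ refl) _ = ≤-trans (≤-trans (m≤n+m _ p) (≤-reflexive p+p̄)) (m≤m+n 1 _)
even-cover {p} p+p̄ eq _ (inj₁ refl) = ≤-trans (≤-trans (m≤n+m _ p) (≤-reflexive p+p̄)) (m≤n+m 1 _)
even-cover {zero}  refl ()   (inj₂ refl) (inj₂ refl)
even-cover {suc p} p+p̄  eq   (inj₂ refl) (inj₂ refl) =
  ≤-trans (m≤n+m _ p) (≤-reflexive (ℕₚ.suc-injective p+p̄))

odd-indep : ∀ {p x y} → p ≤ 1 → x + y ≡ 2 * p + 2 → is3 x ≢ 0 → is3 y ≡ 0
odd-indep {x = 0} _ _ ≢0 = contradiction refl ≢0
odd-indep {x = 1} _ _ ≢0 = contradiction refl ≢0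
odd-indep {x = 2} _ _ ≢0 = contradiction refl ≢0
odd-indep {x = 3} z≤n       ()   _
odd-indep {x = 3} (s≤s z≤n) refl _ = refl
odd-indep {x = suc (suc (suc (suc _)))} _ _ ≢0 = contradiction refl ≢0

even-indep : ∀ {p x y} → x + y ≡ 2 * p + 2 → is0 x ≢ 0 → is0 y ≡ 0
even-indep {p} {zero}  eq _ = cong is0 (trans eq (ℕₚ.+-comm (2 * p) 2))
even-indep {p} {suc _} _ ≢0 = contradiction refl ≢0

regroup : ∀ ab ac bc̄ bc ac̄ → (ab + ac + bc̄) + (ab + bc + ac̄) ≡ 2 * ab + ((ac + ac̄) + (bc + bc̄))
regroup = solve 5 (λ ab ac bc̄ bc ac̄ → (ab :+ ac :+ bc̄) :+ (ab :+ bc :+ ac̄) :=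
  con 2 :* ab :+ ((ac :+ ac̄) :+ (bc :+ bc̄))) refl
  where open ℕ-Solver

-- Labelled graphs

module LabelledGraph
  {V : Set} (_~_ : Rel V 0ℓ) (_~?_ : Decidable _~_)
  (~-sym : Symmetric _~_) (~-irrefl : Irreflexive _≡_ _~_)
  (label : V → V → Sign) (label-sym : ∀ u v → label u v ≡ label v u)
  where

  -- R lists the interior vertices of a walk from x to y.
  Walk : V → List V → V → Set
  Walk x []      y = x ~ y
  Walk x (z ∷ R) y = x ~ z × Walk z R y

  count : Sign → V → List V → V → ℕ
  count σ x []      y = weight σ (label x y)
  count σ x (z ∷ R) y = weight σ (label x z) + count σ z R y

  Walk-++ : ∀ {x} R {z} S {y} → Walk x R z → Walk z S y → Walk x (R ++ z ∷ S) y
  Walk-++ []      S x~z       w = x~z , w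
  Walk-++ (_ ∷ R) S (x~r , v) w = x~r , Walk-++ R S v w

  count-++ : ∀ σ x R z S y →
             count σ x (R ++ z ∷ S) y ≡ count σ x R z + count σ z S y
  count-++ σ x []      z S y = refl
  count-++ σ x (r ∷ R) z S y = trans
    (cong (_+_ (weight σ (label x r))) (count-++ σ r R z S y))
    (sym (ℕₚ.+-assoc (weight σ (label x r)) _ _))

  count-opposite : ∀ σ x R y → count σ x R y + count (opposite σ) x R y ≡ suc (length R)
  count-opposite σ x []      y = weight-opposite σ (label x y)
  count-opposite σ x (z ∷ R) y = trans
    (interchange (weight σ (label x z)) _ (weight (opposite σ) (label x z)) _)
    (cong₂ _+_ (weight-opposite σ (label x z)) (count-opposite σ z R y))

  count≤ : ∀ σ x R y → count σ x R y ≤ suc (length R)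
  count≤ σ x R y = ≤-trans (m≤m+n _ _) (≤-reflexive (count-opposite σ x R y))

  -- Counting non-neighbours

  nonadjacent : V → V → ℕ
  nonadjacent a u = if does (a ~? u) then 0 else 1

  ≤-nonadjacent : ∀ {a b k} → k ≤ 1 → (a ~ b → k ≡ 0) → k ≤ nonadjacent a b
  ≤-nonadjacent {a} {b} k≤1 zero-if with a ~? b
  ... | yes a~b = ≤-reflexive (zero-if a~b)
  ... | no  _   = k≤1

  -- A vertex counts among its own non-neighbours, so on the list of all n vertices the value is n
  -- minus the degree.
  misses : V → List V → ℕ
  misses a L = sum (map (nonadjacent a) L)

  misses-↭ : ∀ a {L M} → L ↭ M → misses a L ≡ misses a M
  misses-↭ a L↭M = sum-↭ (map⁺ (nonadjacent a) L↭M)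

  misses-++ : ∀ a L M → misses a (L ++ M) ≡ misses a L + misses a M
  misses-++ a L M = trans (cong sum (map-++ (nonadjacent a) L M)) (sum-++ (map (nonadjacent a) L) _)

  misses-filter : ∀ a b L → misses b (filter (a ~?_) L) ≤ misses b L
  misses-filter a b []      = z≤n
  misses-filter a b (u ∷ L) with does (a ~? u)
  ... | true  = +-monoʳ-≤ (nonadjacent b u) (misses-filter a b L)
  ... | false = ≤-trans (misses-filter a b L) (m≤n+m _ (nonadjacent b u))

  length-filter-~ : ∀ a L → length L ≡ length (filter (a ~?_) L) + misses a L
  length-filter-~ a []      = refl
  length-filter-~ a (u ∷ L) with does (a ~? u)
  ... | true  = cong suc (length-filter-~ a L)
  ... | false = trans (cong suc (length-filter-~ a L)) (sym (ℕₚ.+-suc _ _))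

  extract : ∀ {u : V} {L} → u ∈ L → ∃[ M ] L ↭ u ∷ M
  extract {u} u∈L with R , S , refl ← ∈-∃++ u∈L = R ++ S , shift u R S

  open module ↭-Solver = CommutativeMonoidSolver (++-commutativeMonoid {A = V})
    using (_⊜_) renaming (_⊕_ to _⊍_; solve to ↭-solve)

  -- Common neighbours and spanning walks under a bound on non-neighbours

  module Dense (q : ℕ) where

    -- The bound `q` does not scale with `L`. It is therefore inherited by every part of a list, and
    -- only lengths have to be watched when vertices are removed.
    record Sparse (L : List V) : Set where
      constructor sparse
      field misses≤ : ∀ a → misses a L ≤ q

    open Sparse

    Sparse-↭ : ∀ {L M} → L ↭ M → Sparse L → Sparse M
    Sparse-↭ L↭M sp .misses≤ a = subst (_≤ q) (misses-↭ a L↭M) (misses≤ sp a)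

    Sparse-++ˡ : ∀ L {M} → Sparse (L ++ M) → Sparse L
    Sparse-++ˡ L {M} sp .misses≤ a =
      ≤-trans (m≤m+n _ _) (subst (_≤ q) (misses-++ a L M) (misses≤ sp a))

    Sparse-++ʳ : ∀ L {M} → Sparse (L ++ M) → Sparse M
    Sparse-++ʳ L {M} sp .misses≤ a =
      ≤-trans (m≤n+m _ (misses a L)) (subst (_≤ q) (misses-++ a L M) (misses≤ sp a))

    -- Each vertex of `as` rules out at most `q` entries of `L`. Repetitions in `as` are allowed,
    -- and `as = []` merely picks an entry.
    commonNeighbour : ∀ as {L} → Sparse L → length as * q < length L →
                      ∃[ u ] u ∈ L × All (_~ u) as
    commonNeighbour []       {u ∷ L} sp lt = u , here refl , []
    commonNeighbour (a ∷ as) {L}     sp lt =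
      let u , u∈ , as~u = commonNeighbour as {filter (a ~?_) L}
                            (sparse λ b → ≤-trans (misses-filter a b L) (misses≤ sp b)) lt′
          u∈L , a~u     = ∈-filter⁻ (a ~?_) {xs = L} u∈
      in u , u∈L , a~u ∷ as~u
      where
      lt′ : length as * q < length (filter (a ~?_) L)
      lt′ = linear (q ∷ length as * q ∷ length (filter (a ~?_) L) ∷ misses a L ∷ [])
              (λ { (q ∷ m ∷ f ∷ r ∷ []) → # 1 ⊕ (q ⊕ m) ⊕ r ≼ (f ⊕ r) ⊕ q ⇒ # 1 ⊕ m ≼ f })
              (subst (suc (q + length as * q) ≤_) (length-filter-~ a L) lt ⊞ misses≤ sp a)

    -- The term nonadjacent z x strengthens the induction.
    insert : ∀ z x Q y → Walk x Q y →
             (∃[ R ] R ↭ z ∷ Q × Walk x R y) ⊎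
             (2 + length Q + nonadjacent z x ≤ 2 * misses z (x ∷ y ∷ Q) + 1)
    insert z x []      y x~y with z ~? x | z ~? y
    ... | yes z~x | yes z~y = inj₁ ([ z ] , ↭-refl , ~-sym z~x , z~y)
    ... | yes _   | no  _   = inj₂ (s≤s (s≤s z≤n))
    ... | no  _   | yes _   = inj₂ (s≤s (s≤s (s≤s z≤n)))
    ... | no  _   | no  _   = inj₂ (s≤s (s≤s (s≤s z≤n)))
    insert z x (r ∷ Q) y (x~r , w) with insert z r Q y w
    ... | inj₁ (R , R↭ , w′) = inj₁ (r ∷ R , ↭-trans (prep r R↭) (swap r z ↭-refl) , x~r , w′)
    -- There is no place for `z` beyond `r`. If it does not fit between `x` and `r` either, at least
    -- one of these two is a non-neighbour, so about half of the walk consists of non-neighbours.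
    ... | inj₂ le with z ~? x | z ~? r
    ...   | yes z~x | yes z~r = inj₁ (z ∷ r ∷ Q , ↭-refl , ~-sym z~x , z~r , w)
    ...   | yes _   | no  _   = inj₂ (linear (length Q ∷ nonadjacent z y ∷ misses z Q ∷ []) (λ { (l ∷ y ∷ m ∷ []) →
      # 2 ⊕ l ⊕ # 1 ≼ 2 ⊛ (# 1 ⊕ (y ⊕ m)) ⊕ # 1 ⇒
      # 3 ⊕ l ⊕ # 0 ≼ 2 ⊛ (# 0 ⊕ (y ⊕ (# 1 ⊕ m))) ⊕ # 1 }) le)
    ...   | no  _   | yes _   = inj₂ (linear (length Q ∷ nonadjacent z y ∷ misses z Q ∷ []) (λ { (l ∷ y ∷ m ∷ []) →
      # 2 ⊕ l ⊕ # 0 ≼ 2 ⊛ (# 0 ⊕ (y ⊕ m)) ⊕ # 1 ⇒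
      # 3 ⊕ l ⊕ # 1 ≼ 2 ⊛ (# 1 ⊕ (y ⊕ (# 0 ⊕ m))) ⊕ # 1 }) le)
    ...   | no  _   | no  _   = inj₂ (linear (length Q ∷ nonadjacent z y ∷ misses z Q ∷ []) (λ { (l ∷ y ∷ m ∷ []) →
      # 2 ⊕ l ⊕ # 1 ≼ 2 ⊛ (# 1 ⊕ (y ⊕ m)) ⊕ # 1 ⇒
      # 3 ⊕ l ⊕ # 1 ≼ 2 ⊛ (# 1 ⊕ (y ⊕ (# 1 ⊕ m))) ⊕ # 1 }) le)

    commonNeighbour₂ : ∀ a b {L} → Sparse L → 2 * q < length L →
                       ∃[ u ] ∃[ M ] L ↭ u ∷ M × a ~ u × b ~ u
    commonNeighbour₂ a b sp lt =
      let u , u∈L , ~u = commonNeighbour (a ∷ b ∷ []) sp lt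
          M , L↭       = extract u∈L
      in u , M , L↭ , All.head ~u , All.head (All.tail ~u)

    commonNeighbour₄ : ∀ a b c d {L} → Sparse L → 4 * q < length L →
                       ∃[ u ] u ∈ L × a ~ u × b ~ u × c ~ u × d ~ u
    commonNeighbour₄ a b c d sp lt =
      let u , u∈L , ~u = commonNeighbour (a ∷ b ∷ c ∷ d ∷ []) sp lt
          ~u′          = All.tail (All.tail ~u)
      in u , u∈L , All.head ~u , All.head (All.tail ~u) , All.head ~u′ , All.head (All.tail ~u′)

    -- If more than `2 * q` vertices are left, one of them is adjacent to the first two vertices of
    -- the walk and goes between them. Otherwise `Q` has at least `2 * q` vertices, and then `z`
    -- itself can be inserted somewhere.
    absorb : ∀ {x y} z W Q → Walk x Q y → Sparse (x ∷ y ∷ Q ++ z ∷ W) →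
             4 * q ≤ length Q + length (z ∷ W) →
             ∃[ u ] ∃[ W′ ] ∃[ Q′ ] z ∷ W ↭ u ∷ W′ × Q′ ↭ u ∷ Q × Walk x Q′ y
    absorb {x} {y} z W Q w sp big = by-size (2 * q ℕ.<? length (z ∷ W))
      where
      near : ∀ Q → Walk x Q y → Sparse (x ∷ y ∷ Q ++ z ∷ W) → 2 * q < length (z ∷ W) →
             ∃[ u ] ∃[ W′ ] ∃[ Q′ ] z ∷ W ↭ u ∷ W′ × Q′ ↭ u ∷ Q × Walk x Q′ y
      near [] _ sp lt =
        let u , W′ , W↭ , x~u , y~u = commonNeighbour₂ x y (Sparse-++ʳ (x ∷ y ∷ []) sp) lt
        in u , W′ , u ∷ [] , W↭ , ↭-refl , x~u , ~-sym y~u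
      near (r ∷ Q) (_ , w) sp lt =
        let u , W′ , W↭ , x~u , r~u = commonNeighbour₂ x r (Sparse-++ʳ (x ∷ y ∷ r ∷ Q) sp) lt
        in u , W′ , u ∷ r ∷ Q , W↭ , ↭-refl , x~u , ~-sym r~u , w

      far : ¬ 2 * q < length (z ∷ W) →
            ¬ 2 + length Q + nonadjacent z x ≤ 2 * misses z (x ∷ y ∷ Q) + 1
      far ≮ le = contradiction
        (linear (q ∷ length Q ∷ length W ∷ nonadjacent z x ∷ misses z (x ∷ y ∷ Q) ∷ [])
          (λ { (q ∷ l ∷ k ∷ a ∷ m ∷ []) →
            (# 2 ⊕ l ⊕ a) ⊕ (4 ⊛ q ⊕ ((# 1 ⊕ k) ⊕ 2 ⊛ m)) ≼
            (2 ⊛ m ⊕ # 1) ⊕ ((l ⊕ (# 1 ⊕ k)) ⊕ (2 ⊛ q ⊕ 2 ⊛ q)) ⇒ # 1 ≼ # 0 })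
          (le ⊞ big ⊞ ℕₚ.≮⇒≥ ≮ ⊞ 2 ⊡ misses≤ (Sparse-++ˡ (x ∷ y ∷ Q) sp) z))
        λ ()

      by-size : Dec (2 * q < length (z ∷ W)) →
                ∃[ u ] ∃[ W′ ] ∃[ Q′ ] z ∷ W ↭ u ∷ W′ × Q′ ↭ u ∷ Q × Walk x Q′ y
      by-size (yes lt) = near Q w sp lt
      by-size (no ≮) with insert z x Q y w
      ... | inj₁ (Q′ , Q′↭ , w′) = z , W , Q′ , ↭-refl , Q′↭ , w′
      ... | inj₂ le              = contradiction le (far ≮)

    -- The recursion is on the length `k`, because the absorbed vertex need not be the head of `W`.
    -- The total length of `Q` and `W` is invariant, so the size condition of `absorb` persists.
    absorbAll : ∀ k W Q {x y} → length W ≡ k → Walk x Q y → Sparse (x ∷ y ∷ Q ++ W) →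
                4 * q ≤ length Q + length W → ∃[ R ] R ↭ Q ++ W × Walk x R y
    absorbAll zero    []      Q eq w sp big = Q , ↭-sym (++-identityʳ Q) , w
    absorbAll (suc k) (z ∷ W) Q {x} {y} eq w sp big =
      let u , W′ , Q′ , W↭ , Q′↭ , w′ = absorb z W Q w sp big
          perm : Q′ ++ W′ ↭ Q ++ z ∷ W
          perm = ↭-trans (++⁺ʳ W′ Q′↭) (↭-trans (↭-sym (shift u Q W′)) (++⁺ˡ Q (↭-sym W↭)))
          R , R↭ , w″ = absorbAll k W′ Q′ (trans (ℕₚ.suc-injective (sym (↭-length W↭))) (ℕₚ.suc-injective eq)) w′
            (Sparse-↭ (prep x (prep y (↭-sym perm))) sp)
            (≤-trans big (≤-reflexive
              (trans (sym (length-++ Q)) (trans (sym (↭-length perm)) (length-++ Q′)))))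
      in R , ↭-trans R↭ perm , w″

    -- The ends need not be adjacent, so the first walk goes through a common neighbour; the other
    -- vertices are then absorbed.
    spanningWalk : ∀ x y U → Sparse (x ∷ y ∷ U) → 4 * q < length U →
                   ∃[ R ] R ↭ U × Walk x R y
    spanningWalk x y U sp big =
      let u , W , U↭ , x~u , y~u = commonNeighbour₂ x y (Sparse-++ʳ (x ∷ y ∷ []) sp)
            (≤-trans (s≤s (ℕₚ.*-monoˡ-≤ q {2} {4} (s≤s (s≤s z≤n)))) big)
          R , R↭ , w = absorbAll _ W (u ∷ []) refl (x~u , ~-sym y~u)
            (Sparse-↭ (prep x (prep y U↭)) sp)
            (subst (4 * q ≤_) (↭-length U↭) (ℕₚ.<⇒≤ big))
      in R , ↭-trans R↭ (↭-sym U↭) , w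

    -- The structure of vertex sets without switches

    K₄ : V → V → V → V → Set
    K₄ a b c d = (a ~ b × a ~ c × a ~ d) × (b ~ c × b ~ d × c ~ d)

    -- The paths a b c d and a c b d share the edge bc, so comparing their sums amounts to comparing
    -- the matchings ab, cd and ac, bd.
    pairing : V → V → V → V → ℕ
    pairing a b c d = weight Sign.+ (label a b) + weight Sign.+ (label c d)

    Rigid : List V → Set
    Rigid U = ∀ {a b c d} → a ∈ U → b ∈ U → c ∈ U → d ∈ U → K₄ a b c d →
              pairing a b c d ≡ pairing a c b d

    -- centre is an indicator function, namely of the vertices whose value
    -- differs from the common one by 2.
    record Biased (U : List V) : Set where
      field
        rare   : Sign
        centre : V → ℕ
        cover  : ∀ {a b} → a ∈ U → b ∈ U → a ~ b → weight rare (label a b) ≤ centre a + centre b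
        few    : sum (map centre U) ≤ q

    -- Unless `X` vanishes on `U`, fix `a` in its support. By hypothesis `X` is then bounded on `U`
    -- by the indicator of the non-neighbours of `a`, whose sum is at most `q`.
    sum-independent : ∀ (X : V → ℕ) U → Sparse U →
                      (∀ {a b} → a ∈ U → b ∈ U → X a ≢ 0 → X b ≤ nonadjacent a b) →
                      sum (map X U) ≤ q
    sum-independent X U sp indep with All.all? (λ a → X a ℕ.≟ 0) U
    ... | yes all0 = ≤-trans (≤-reflexive (vanish U all0)) z≤n
      where
      vanish : ∀ L → All (λ a → X a ≡ 0) L → sum (map X L) ≡ 0
      vanish []      []         = refl
      vanish (u ∷ L) (eq ∷ eqs) = cong₂ _+_ eq (vanish L eqs)
    ... | no ¬all0 =
      let a , a∈U , Xa≢0 = find (¬All⇒Any¬ (λ a → X a ℕ.≟ 0) U ¬all0)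
      in ≤-trans (dominate a U (λ b∈U → indep a∈U b∈U Xa≢0)) (misses≤ sp a)
      where
      dominate : ∀ a L → (∀ {b} → b ∈ L → X b ≤ nonadjacent a b) → sum (map X L) ≤ misses a L
      dominate a []      le = z≤n
      dominate a (b ∷ L) le = le (here refl) ⊞ dominate a L (le ∘ there)

    module _ {U : List V} (sp : Sparse U) (big : 4 * q < length U) (rigid : Rigid U) where

      private
        p p̄ : V → V → ℕ
        p a b = weight Sign.+ (label a b)
        p̄ a b = weight Sign.- (label a b)

        p-sym : ∀ a b → p a b ≡ p b a
        p-sym a b = cong (weight Sign.+) (label-sym a b)

        p̄-sym : ∀ a b → p̄ a b ≡ p̄ b a
        p̄-sym a b = cong (weight Sign.-) (label-sym a b)

        p+p̄ : ∀ a b → p a b + p̄ a b ≡ 1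
        p+p̄ a b = weight-opposite Sign.+ (label a b)

        p≤1 : ∀ a b → p a b ≤ 1
        p≤1 a b = weight≤1 Sign.+ (label a b)

      -- If the labels ±1 have the form g a + g b, this is g a + 3/2.
      τ : V → V → V → ℕ
      τ a b c = p a b + p a c + p̄ b c

      τ-flip : ∀ a b c → τ a b c ≡ τ a c b
      τ-flip a b c = cong₂ _+_ (ℕₚ.+-comm (p a b) (p a c)) (p̄-sym b c)

      -- Rigidity for the matchings ab, cd and ad, bc gives f(ab) - f(bc) = f(ad) - f(cd): in the
      -- triangle at `a`, the vertex `b` may be exchanged for `d`.
      τ-move : ∀ {a b c d} → a ∈ U → b ∈ U → c ∈ U → d ∈ U → K₄ a b c d → τ a b c ≤ τ a c d
      τ-move {a} {b} {c} {d} a∈ b∈ c∈ d∈ ((a~b , a~c , a~d) , (b~c , b~d , c~d)) =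
        linear (p a b ∷ p a c ∷ p a d ∷ p b c ∷ p c d ∷ p̄ b c ∷ p̄ c d ∷ [])
          (λ { (ab ∷ ac ∷ ad ∷ bc ∷ cd ∷ bc̄ ∷ cd̄ ∷ []) →
            (ab ⊕ cd) ⊕ ((bc ⊕ bc̄) ⊕ # 1) ≼ (ad ⊕ bc) ⊕ (# 1 ⊕ (cd ⊕ cd̄)) ⇒
            ab ⊕ ac ⊕ bc̄ ≼ ac ⊕ ad ⊕ cd̄ })
          (≤-reflexive (trans (cong (_+_ (p a b)) (p-sym c d))
             (rigid a∈ b∈ d∈ c∈ ((a~b , a~d , a~c) , (b~d , b~c , ~-sym c~d))))
           ⊞ ≤-reflexive (p+p̄ b c) ⊞ ≤-reflexive (sym (p+p̄ c d)))

      τ≤τ : ∀ {a b c d e} → a ∈ U → b ∈ U → c ∈ U → d ∈ U → e ∈ U →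
            a ~ b → a ~ c → b ~ c → a ~ d → a ~ e → d ~ e → τ a b c ≤ τ a d e
      τ≤τ {a} {b} {c} {d} {e} a∈ b∈ c∈ d∈ e∈ a~b a~c b~c a~d a~e d~e =
        -- `z` leads from the first triangle to `d`. Since `c`, `d` and `z`, `e` need not be
        -- adjacent, `y` bridges the first pair and `w` the second. `τ-flip` changes which vertex
        -- the next `τ-move` drops.
        let z , z∈ , a~z , b~z , c~z , d~z = commonNeighbour₄ a b c d sp big
            y , y∈ , a~y , c~y , z~y , d~y = commonNeighbour₄ a c z d sp big
            w , w∈ , a~w , z~w , d~w , e~w = commonNeighbour₄ a z d e sp big
        in begin
          τ a b c ≤⟨ τ-move a∈ b∈ c∈ z∈ ((a~b , a~c , a~z) , (b~c , b~z , c~z)) ⟩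
          τ a c z ≤⟨ τ-move a∈ c∈ z∈ y∈ ((a~c , a~z , a~y) , (c~z , c~y , z~y)) ⟩
          τ a z y ≡⟨ τ-flip a z y ⟩
          τ a y z ≤⟨ τ-move a∈ y∈ z∈ d∈ ((a~y , a~z , a~d) , (~-sym z~y , ~-sym d~y , ~-sym d~z)) ⟩
          τ a z d ≤⟨ τ-move a∈ z∈ d∈ w∈ ((a~z , a~d , a~w) , (~-sym d~z , z~w , d~w)) ⟩
          τ a d w ≡⟨ τ-flip a d w ⟩
          τ a w d ≤⟨ τ-move a∈ w∈ d∈ e∈ ((a~w , a~d , a~e) , (~-sym d~w , ~-sym e~w , d~e)) ⟩
          τ a d e ∎
        where open ℕₚ.≤-Reasoning

      -- One fixed triangle at each vertex makes `η` a function of the vertex alone. The repeated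
      -- arguments only fill up the four places.
      nb nc : V → V
      nb a = proj₁ (commonNeighbour₄ a a a a sp big)
      nc a = proj₁ (commonNeighbour₄ a (nb a) a a sp big)

      η : V → ℕ
      η a = τ a (nb a) (nc a)

      η-triangle : ∀ {a b c} → a ∈ U → b ∈ U → c ∈ U → a ~ b → a ~ c → b ~ c → η a ≡ τ a b c
      η-triangle {a} a∈ b∈ c∈ a~b a~c b~c =
        let _ , x∈ , a~x , _       = commonNeighbour₄ a a a a sp big
            _ , y∈ , a~y , x~y , _ = commonNeighbour₄ a (nb a) a a sp big
        in ℕₚ.≤-antisym (τ≤τ a∈ x∈ y∈ b∈ c∈ a~x a~y x~y a~b a~c b~c)
                        (τ≤τ a∈ b∈ c∈ x∈ y∈ a~b a~c b~c a~x a~y x~y)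

      -- This is f(ab) = g(a) + g(b), with `η` = g + 3/2 and f(ab) = 2p - 1. On a triangle abc the
      -- contributions of ac and bc add up to constants.
      η-edge : ∀ {a b} → a ∈ U → b ∈ U → a ~ b → η a + η b ≡ 2 * p a b + 2
      η-edge {a} {b} a∈ b∈ a~b =
        let c , c∈ , a~c , b~c , _ = commonNeighbour₄ a b a b sp big in begin
          η a + η b
            ≡⟨ cong₂ _+_ (η-triangle a∈ b∈ c∈ a~b a~c b~c) (η-triangle b∈ a∈ c∈ (~-sym a~b) b~c a~c) ⟩
          (p a b + p a c + p̄ b c) + (p b a + p b c + p̄ a c)
            ≡⟨ cong (λ k → (p a b + p a c + p̄ b c) + (k + p b c + p̄ a c)) (p-sym b a) ⟩
          (p a b + p a c + p̄ b c) + (p a b + p b c + p̄ a c)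
            ≡⟨ regroup (p a b) (p a c) (p̄ b c) (p b c) (p̄ a c) ⟩
          2 * p a b + ((p a c + p̄ a c) + (p b c + p̄ b c))
            ≡⟨ cong (_+_ (2 * p a b)) (cong₂ _+_ (p+p̄ a c) (p+p̄ b c)) ⟩
          2 * p a b + 2 ∎
        where open ≡-Reasoning

      η≤3 : ∀ a → η a ≤ 3
      η≤3 a = (p≤1 _ _ ⊞ p≤1 _ _) ⊞ weight≤1 Sign.- _

      -- Any two vertices of `U` are joined through a common neighbour in `U`, and parity is
      -- preserved along both edges.
      η-Odd : ∀ {a b} → a ∈ U → b ∈ U → Odd (η a) → Odd (η b)
      η-Odd {a} {b} a∈ b∈ odd =
        let z , z∈ , a~z , b~z , _ = commonNeighbour₄ a b a b sp big
        in odd-step (p≤1 b z) (trans (ℕₚ.+-comm (η z) (η b)) (η-edge b∈ z∈ b~z))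
             (odd-step (p≤1 a z) (η-edge a∈ z∈ a~z) odd)

      η-Even : ∀ {a b} → a ∈ U → b ∈ U → Even (η a) → Even (η b)
      η-Even {a} {b} a∈ b∈ even =
        let z , z∈ , a~z , b~z , _ = commonNeighbour₄ a b a b sp big
        in even-step (η≤3 b) (p≤1 b z) (trans (ℕₚ.+-comm (η z) (η b)) (η-edge b∈ z∈ b~z))
             (even-step (η≤3 z) (p≤1 a z) (η-edge a∈ z∈ a~z) even)

      -- Parity is constant on `U`. Odd values 1, 3 mean g = -1/2, 3/2, and even values 2, 0 mean g
      -- = 1/2, -3/2, which is the same situation with the signs exchanged.
      rigid⇒biased : Biased U
      rigid⇒biased =
        let o , o∈ , _ = commonNeighbour [] sp (ℕₚ.m<n⇒0<n big)
        in by-parity o∈ (even-or-odd (η≤3 o))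
        where
        by-parity : ∀ {o} → o ∈ U → Even (η o) ⊎ Odd (η o) → Biased U
        by-parity {o} o∈ (inj₂ odd) = record
          { rare   = Sign.+
          ; centre = λ a → is3 (η a)
          ; cover  = λ a∈ b∈ a~b → odd-cover (p≤1 _ _) (η-edge a∈ b∈ a~b) (η-Odd o∈ a∈ odd) (η-Odd o∈ b∈ odd)
          ; few    = sum-independent _ U sp indep
          }
          where
          indep : ∀ {a b} → a ∈ U → b ∈ U → is3 (η a) ≢ 0 → is3 (η b) ≤ nonadjacent a b
          indep {a} {b} a∈ b∈ ≢0 = ≤-nonadjacent (is3≤1 (η b))
            λ a~b → odd-indep (p≤1 a b) (η-edge a∈ b∈ a~b) ≢0
        by-parity {o} o∈ (inj₁ even) = record
          { rare   = Sign.-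
          ; centre = λ a → is0 (η a)
          ; cover  = λ {a} {b} a∈ b∈ a~b →
              even-cover (p+p̄ a b) (η-edge a∈ b∈ a~b) (η-Even o∈ a∈ even) (η-Even o∈ b∈ even)
          ; few    = sum-independent _ U sp indep
          }
          where
          indep : ∀ {a b} → a ∈ U → b ∈ U → is0 (η a) ≢ 0 → is0 (η b) ≤ nonadjacent a b
          indep {a} {b} a∈ b∈ ≢0 = ≤-nonadjacent (is0≤1 (η b))
            λ a~b → even-indep {weight Sign.+ (label a b)} (η-edge a∈ b∈ a~b) ≢0

    -- Rare edges on a walk through a biased set

    module _ {U : List V} (B : Biased U) where
      open Biased B

      -- Every edge inside `U` is charged to its ends. The vertices of `R` lie on two edges of the
      -- walk and `r` on one; the last edge may leave `U` and costs 1.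
      count-inner : ∀ {r} R {y} → r ∈ U → (∀ {u} → u ∈ R → u ∈ U) → Walk r R y →
                    count rare r R y ≤ centre r + 2 * sum (map centre R) + 1
      count-inner {r} []      {y} r∈ R⊆ w = ≤-trans (weight≤1 rare (label r y)) (m≤n+m 1 _)
      count-inner {r} (s ∷ R) {y} r∈ R⊆ (r~s , w) =
        linear (weight rare (label r s) ∷ count rare s R y ∷ centre r ∷ centre s ∷ sum (map centre R) ∷ [])
          (λ { (e ∷ c ∷ x ∷ x′ ∷ S ∷ []) →
            e ⊕ c ≼ (x ⊕ x′) ⊕ (x′ ⊕ 2 ⊛ S ⊕ # 1) ⇒ e ⊕ c ≼ x ⊕ 2 ⊛ (x′ ⊕ S) ⊕ # 1 })
          (cover r∈ (R⊆ (here refl)) r~s ⊞ count-inner R (R⊆ (here refl)) (R⊆ ∘ there) w)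

      count-rare : ∀ {x} R {y} → R ↭ U → Walk x R y → count rare x R y ≤ 2 * q + 2
      count-rare {x} []      {y} R↭U w = ≤-trans (weight≤1 rare (label x y)) (≤-trans (s≤s z≤n) (m≤n+m 2 _))
      count-rare {x} (r ∷ R) {y} R↭U (_ , w) =
        linear (weight rare (label x r) ∷ count rare r R y ∷ centre r ∷ sum (map centre R) ∷ q ∷ [])
          (λ { (e ∷ c ∷ x ∷ S ∷ q ∷ []) →
            e ⊕ (c ⊕ 2 ⊛ (x ⊕ S)) ≼ # 1 ⊕ ((x ⊕ 2 ⊛ S ⊕ # 1) ⊕ 2 ⊛ q) ⇒ e ⊕ c ≼ 2 ⊛ q ⊕ # 2 })
          (weight≤1 rare (label x r)
           ⊞ count-inner R (∈-resp-↭ R↭U (here refl)) (∈-resp-↭ R↭U ∘ there) w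
           ⊞ 2 ⊡ subst (_≤ q) (sum-↭ (map⁺ centre (↭-sym R↭U))) few)

    -- Then the paths a c b d and a b c d have the same ends and the same
    -- vertices, and the first has more positive edges.
    Switch : V → V → V → V → Set
    Switch a b c d = K₄ a b c d × pairing a b c d < pairing a c b d

    switch? : ∀ a b c d → Dec (Switch a b c d)
    switch? a b c d =
      ((a ~? b ×-dec a ~? c ×-dec a ~? d) ×-dec (b ~? c ×-dec b ~? d ×-dec c ~? d))
      ×-dec (pairing a b c d ℕ.<? pairing a c b d)

    rigid-or-switch : ∀ U → Rigid U ⊎
      (∃[ a ] ∃[ b ] ∃[ c ] ∃[ d ] a ∈ U × b ∈ U × c ∈ U × d ∈ U × Switch a b c d)
    rigid-or-switch U = search (any? (λ a → any? (λ b → any? (λ c → any? (switch? a b c) U) U) U) U)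
      where
      search : Dec (Any (λ a → Any (λ b → Any (λ c → Any (Switch a b c) U) U) U) U) →
               Rigid U ⊎
               (∃[ a ] ∃[ b ] ∃[ c ] ∃[ d ] a ∈ U × b ∈ U × c ∈ U × d ∈ U × Switch a b c d)
      search (yes found) =
        let a , a∈ , found₁ = find found
            b , b∈ , found₂ = find found₁
            c , c∈ , found₃ = find found₂
            d , d∈ , s      = find found₃
        in inj₂ (a , b , c , d , a∈ , b∈ , c∈ , d∈ , s)
      -- No switch on a, c, b, d gives one inequality, and none on a, b, c, d the other.
      search (no none) = inj₁ λ a∈ b∈ c∈ d∈ k@((a~b , a~c , a~d) , (b~c , b~d , c~d)) →
        ℕₚ.≤-antisym
          (ℕₚ.≮⇒≥ λ lt → none (lose a∈ (lose c∈ (lose b∈ (lose d∈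
             (((a~c , a~b , a~d) , (~-sym b~c , c~d , b~d)) , lt))))))
          (ℕₚ.≮⇒≥ λ lt → none (lose a∈ (lose b∈ (lose c∈ (lose d∈ (k , lt))))))

    ∈-tail : ∀ {a b : V} {M} → a ~ b → b ∈ a ∷ M → b ∈ M
    ∈-tail a~b (here refl) = contradiction a~b (~-irrefl refl)
    ∈-tail a~b (there b∈M) = b∈M

    extract₄ : ∀ {a b c d U} → K₄ a b c d → a ∈ U → b ∈ U → c ∈ U → d ∈ U →
               ∃[ M ] U ↭ a ∷ b ∷ c ∷ d ∷ M
    extract₄ {a} {b} {c} ((a~b , a~c , a~d) , (b~c , b~d , c~d)) a∈ b∈ c∈ d∈ =
      let M₁ , U↭  = extract a∈
          M₂ , M₁↭ = extract (∈-tail a~b (∈-resp-↭ U↭ b∈))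
          M₃ , M₂↭ = extract (∈-tail b~c (∈-resp-↭ M₁↭ (∈-tail a~c (∈-resp-↭ U↭ c∈))))
          M₄ , M₃↭ = extract (∈-tail c~d (∈-resp-↭ M₂↭ (∈-tail b~d (∈-resp-↭ M₁↭ (∈-tail a~d (∈-resp-↭ U↭ d∈))))))
      in M₄ , ↭-trans U↭ (prep a (↭-trans M₁↭ (prep b (↭-trans M₂↭ (prep c M₃↭)))))

    -- 64 is not optimal: it leaves room for the 10T + 2 vertices of a ladder
    -- of length 2T and for the rounding in the choice of T.
    module _ (vertices : List V) (sp : Sparse vertices)
             (T : ℕ) (1≤T : 1 ≤ T) (large : 4 * q + 64 * T ≤ length vertices) where

      -- Ladders of switches and their completion to spanning cycles

      record Unbalanced : Set where
        field
          start    : V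
          interior : List V
          spans    : start ∷ interior ↭ vertices
          cycle    : Walk start interior start
          rare     : Sign
          -- The cycle has as many edges as vertices, so the opposite sign occurs at least `T` times
          -- more often than `rare`.
          few      : 2 * count rare start interior start + T ≤ length vertices

      -- The walks low and high traverse the same k switches, in opposite ways.
      record Ladder (k : ℕ) : Set where
        field
          start end     : V
          low high rest : List V
          low↭high      : low ↭ high
          spans         : start ∷ end ∷ low ++ rest ↭ vertices
          lowWalk       : Walk start low end
          highWalk      : Walk start high end
          length-low    : length low ≡ 5 * k
          gain          : count Sign.+ start low end + k ≤ count Sign.+ start high end

      module _ {k : ℕ} (k≤2T : k ≤ 2 * T) (l : Ladder k) where
        open Ladder l

        sp-rest : Sparse rest
        sp-rest = Sparse-++ʳ (start ∷ end ∷ low) (Sparse-↭ (↭-sym spans) sp)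

        rest-large : 4 * q + 52 ≤ length rest
        -- The ladder has `5 * k + 2` vertices, at most `10 * T + 2`; what remains is
        -- `4 * q + 54 * T - 2` or more, and `T` is at least 1.
        rest-large = linear (q ∷ T ∷ k ∷ length rest ∷ [])
          (λ { (q ∷ T ∷ k ∷ r ∷ []) →
            (4 ⊛ q ⊕ 64 ⊛ T) ⊕ (5 ⊛ k ⊕ 54 ⊛ # 1) ≼ (# 2 ⊕ (5 ⊛ k ⊕ r)) ⊕ (5 ⊛ (2 ⊛ T) ⊕ 54 ⊛ T) ⇒
            4 ⊛ q ⊕ # 52 ≼ r })
          (≤-trans large (≤-reflexive length-vertices) ⊞ 5 ⊡ k≤2T ⊞ 54 ⊡ 1≤T)
          where
          length-vertices : length vertices ≡ 2 + (5 * k + length rest)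
          length-vertices = trans (sym (↭-length spans)) (cong (_+_ 2)
            (trans (length-++ low) (cong (_+ length rest) length-low)))

        rest>4q : 4 * q < length rest
        rest>4q = ≤-trans (≤-reflexive (sym (ℕₚ.+-comm (4 * q) 1)))
                    (≤-trans (+-monoʳ-≤ (4 * q) (s≤s z≤n)) rest-large)

        extend : Rigid rest ⊎ Ladder (suc k)
        extend with rigid-or-switch rest
        ... | inj₁ rigid = inj₁ rigid
        ... | inj₂ (a , b , c , d , a∈ , b∈ , c∈ , d∈ , switch) =
          let M , rest↭ = extract₄ (proj₁ switch) a∈ b∈ c∈ d∈
              w , N , M↭ , e~w , a~w = commonNeighbour₂ end a
                (Sparse-++ʳ (a ∷ b ∷ c ∷ d ∷ []) (Sparse-↭ rest↭ sp-rest))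
                (M-large (↭-length rest↭))
          in inj₂ (step switch e~w (~-sym a~w)
               (↭-trans rest↭ (prep a (prep b (prep c (prep d M↭))))))
          where
          M-large : ∀ {m} → length rest ≡ 4 + m → 2 * q < m
          M-large {m} eq = linear (q ∷ m ∷ [])
            (λ { (q ∷ m ∷ []) → 4 ⊛ q ⊕ # 52 ≼ # 4 ⊕ m ⇒ # 1 ⊕ 2 ⊛ q ≼ m })
            (≤-trans rest-large (≤-reflexive eq))

          -- The old end becomes an interior vertex and is followed by `w`, `a` and the two middle
          -- vertices of the switch, with `d` as the new end: five more interior vertices and a gain
          -- of at least one positive edge.
          step : ∀ {a b c d w N} → Switch a b c d →
                 end ~ w → w ~ a → rest ↭ a ∷ b ∷ c ∷ d ∷ w ∷ N → Ladder (suc k)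
          step {a} {b} {c} {d} {w} {N} (((a~b , a~c , _) , (b~c , b~d , c~d)) , lt) e~w w~a rest↭ = record
            { start      = start
            ; end        = d
            ; low        = low ++ end ∷ w ∷ a ∷ b ∷ c ∷ []
            ; high       = high ++ end ∷ w ∷ a ∷ c ∷ b ∷ []
            ; rest       = N
            ; low↭high   = ++⁺ low↭high (prep end (prep w (prep a (swap b c ↭-refl))))
            ; spans      = ↭-trans
                (↭-solve 9 (λ s e L a b c d w N →
                   s ⊍ (d ⊍ ((L ⊍ (e ⊍ (w ⊍ (a ⊍ (b ⊍ c))))) ⊍ N)) ⊜
                   s ⊍ (e ⊍ (L ⊍ (a ⊍ (b ⊍ (c ⊍ (d ⊍ (w ⊍ N)))))))) ↭-refl
                   [ start ] [ end ] low [ a ] [ b ] [ c ] [ d ] [ w ] N)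
                (↭-trans (prep start (prep end (++⁺ˡ low (↭-sym rest↭)))) spans)
            ; lowWalk    = Walk-++ low _ lowWalk (e~w , w~a , a~b , b~c , c~d)
            ; highWalk   = Walk-++ high _ highWalk (e~w , w~a , a~c , ~-sym b~c , b~d)
            ; length-low = trans (length-++ low) (trans (cong (_+ 5) length-low)
                             (trans (ℕₚ.+-comm (5 * k) 5) (sym (ℕₚ.*-suc 5 k))))
            ; gain       = subst₂ (λ x y → x + suc k ≤ y)
                (sym (count-++ Sign.+ start low end _ d)) (sym (count-++ Sign.+ start high end _ d)) gain′
            }
            where
            p : V → V → ℕ
            p x y = weight Sign.+ (label x y)

            gain′ : (count Sign.+ start low end + (p end w + (p w a + (p a b + (p b c + p c d))))) + suc k ≤
                    count Sign.+ start high end + (p end w + (p w a + (p a c + (p c b + p b d))))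
            gain′ = linear (count Sign.+ start low end ∷ count Sign.+ start high end ∷ k ∷
                            p end w ∷ p w a ∷ p a b ∷ p b c ∷ p c d ∷ p a c ∷ p c b ∷ p b d ∷ [])
              (λ { (L ∷ H ∷ k ∷ ew ∷ wa ∷ ab ∷ bc ∷ cd ∷ ac ∷ cb ∷ bd ∷ []) →
                (L ⊕ k) ⊕ ((# 1 ⊕ (ab ⊕ cd)) ⊕ bc) ≼ H ⊕ ((ac ⊕ bd) ⊕ cb) ⇒
                (L ⊕ (ew ⊕ (wa ⊕ (ab ⊕ (bc ⊕ cd))))) ⊕ (# 1 ⊕ k) ≼
                H ⊕ (ew ⊕ (wa ⊕ (ac ⊕ (cb ⊕ bd)))) })
              (gain ⊞ lt ⊞ ≤-reflexive (cong (weight Sign.+) (label-sym b c)))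

        link : ∃[ R ] R ↭ rest × Walk end R start
        link = spanningWalk end start rest
          (Sparse-++ˡ (end ∷ start ∷ rest) (Sparse-↭ reorder sp)) rest>4q
          where
          reorder : vertices ↭ (end ∷ start ∷ rest) ++ low
          reorder = ↭-trans (↭-sym spans)
            (↭-solve 4 (λ s e L r → s ⊍ (e ⊍ (L ⊍ r)) ⊜ (e ⊍ (s ⊍ r)) ⊍ L) ↭-refl
               [ start ] [ end ] low rest)

        R : List V
        R = proj₁ link

        spans-low : start ∷ low ++ end ∷ R ↭ vertices
        spans-low = ↭-trans (prep start (↭-trans (shift end low R) (prep end (++⁺ˡ low (proj₁ (proj₂ link)))))) spans

        spans-high : start ∷ high ++ end ∷ R ↭ vertices
        spans-high = ↭-trans (prep start (++⁺ʳ (end ∷ R) (↭-sym low↭high))) spans-low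

        rigid⇒unbalanced : Rigid rest → Unbalanced
        rigid⇒unbalanced rigid = record
          { start    = start
          ; interior = low ++ end ∷ R
          ; spans    = spans-low
          ; cycle    = Walk-++ low R lowWalk (proj₂ (proj₂ link))
          ; rare     = σ
          ; few      = subst (λ c → 2 * c + T ≤ length vertices) (sym (count-++ σ start low end R start))
              (≤-trans few large)
          }
          where
          biased = rigid⇒biased sp-rest rest>4q rigid
          σ = Biased.rare biased
          -- All `5 * k + 1` edges of the ladder may be rare, and at most `2 * q + 2` others are.
          -- Doubling gives at most `4 * q + 20 * T + 6`.
          few : 2 * (count σ start low end + count σ end R start) + T ≤ 4 * q + 64 * T
          few = linear (count σ start low end ∷ count σ end R start ∷ q ∷ T ∷ k ∷ [])
            (λ { (c₁ ∷ c₂ ∷ q ∷ T ∷ k ∷ []) →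
              2 ⊛ c₁ ⊕ (2 ⊛ c₂ ⊕ (10 ⊛ k ⊕ 6 ⊛ # 1)) ≼
              2 ⊛ (# 1 ⊕ 5 ⊛ k) ⊕ (2 ⊛ (2 ⊛ q ⊕ # 2) ⊕ (10 ⊛ (2 ⊛ T) ⊕ 6 ⊛ T)) ⇒
              2 ⊛ (c₁ ⊕ c₂) ⊕ T ≼ 4 ⊛ q ⊕ 64 ⊛ T })
            (2 ⊡ ≤-trans (count≤ σ start low end) (≤-reflexive (cong suc length-low))
             ⊞ 2 ⊡ count-rare biased R (proj₁ (proj₂ link)) (proj₂ (proj₂ link))
             ⊞ 10 ⊡ k≤2T ⊞ 6 ⊡ 1≤T)

      -- The two cycles differ by at least `2 * T` positive edges. If the low one fails, so that
      -- `2 * lo + T` exceeds n, then `2 * hi` exceeds n + 3T, and the negative edges are rare on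
      -- the high one.
      full⇒unbalanced : Ladder (2 * T) → Unbalanced
      full⇒unbalanced l = choose (2 * lo + T ℕ.≤? length vertices)
        where
        open Ladder l
        S  = R ≤-refl l
        wS = proj₂ (proj₂ (link ≤-refl l))
        lo = count Sign.+ start (low ++ end ∷ S) start
        hi = count Sign.+ start (high ++ end ∷ S) start
        hi⁻ = count Sign.- start (high ++ end ∷ S) start

        lo+2T≤hi : lo + 2 * T ≤ hi
        lo+2T≤hi = subst₂ (λ x y → x + 2 * T ≤ y)
          (sym (count-++ Sign.+ start low end S start)) (sym (count-++ Sign.+ start high end S start))
          (linear (count Sign.+ start low end ∷ count Sign.+ start high end ∷ count Sign.+ end S start ∷ T ∷ [])
            (λ { (L ∷ H ∷ c ∷ T ∷ []) → L ⊕ 2 ⊛ T ≼ H ⇒ (L ⊕ c) ⊕ 2 ⊛ T ≼ H ⊕ c }) gain)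

        choose : Dec (2 * lo + T ≤ length vertices) → Unbalanced
        choose (yes le) = record
          { start    = start
          ; interior = low ++ end ∷ S
          ; spans    = spans-low ≤-refl l
          ; cycle    = Walk-++ low S lowWalk wS
          ; rare     = Sign.+
          ; few      = le
          }
        choose (no ≰) = record
          { start    = start
          ; interior = high ++ end ∷ S
          ; spans    = spans-high ≤-refl l
          ; cycle    = Walk-++ high S highWalk wS
          ; rare     = Sign.-
          ; few      = linear (lo ∷ hi ∷ hi⁻ ∷ T ∷ length vertices ∷ [])
              (λ { (L ∷ H ∷ H⁻ ∷ T ∷ n ∷ []) →
                (# 1 ⊕ n) ⊕ (2 ⊛ (L ⊕ 2 ⊛ T) ⊕ 2 ⊛ (H ⊕ H⁻)) ≼ (2 ⊛ L ⊕ T) ⊕ (2 ⊛ H ⊕ 2 ⊛ n) ⇒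
                2 ⊛ H⁻ ⊕ T ≼ n })
              (ℕₚ.≰⇒> ≰ ⊞ 2 ⊡ lo+2T≤hi
               ⊞ 2 ⊡ ≤-reflexive (trans (count-opposite Sign.+ start (high ++ end ∷ S) start)
                                        (↭-length (spans-high ≤-refl l))))
          }

      edge-ladder : Ladder 0
      edge-ladder =
        let v , v∈ , _ = commonNeighbour [] sp (linear (q ∷ T ∷ length vertices ∷ [])
              (λ { (q ∷ T ∷ n ∷ []) → # 1 ⊕ (4 ⊛ q ⊕ 64 ⊛ T) ≼ T ⊕ n ⇒ # 1 ≼ n }) (1≤T ⊞ large))
            M , v∷M = extract v∈
            e , N , M↭ , v~e , _ = commonNeighbour₂ v v (Sparse-++ʳ (v ∷ []) (Sparse-↭ v∷M sp))
              (linear (q ∷ T ∷ length M ∷ [])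
                (λ { (q ∷ T ∷ m ∷ []) → 2 ⊛ # 1 ⊕ (4 ⊛ q ⊕ 64 ⊛ T) ≼ 2 ⊛ T ⊕ (# 1 ⊕ m) ⇒ # 1 ⊕ 2 ⊛ q ≼ m })
                (2 ⊡ 1≤T ⊞ ≤-trans large (≤-reflexive (↭-length v∷M))))
        in record
          { start = v ; end = e ; low = [] ; high = [] ; rest = N
          ; low↭high = ↭-refl
          ; spans = ↭-sym (↭-trans v∷M (prep v M↭))
          ; lowWalk = v~e ; highWalk = v~e
          ; length-low = refl
          ; gain = ≤-reflexive (ℕₚ.+-identityʳ _)
          }

      grow : ∀ k → k ≤ 2 * T → Ladder k ⊎ Unbalanced
      grow zero    _    = inj₁ edge-ladder
      grow (suc k) k<2T with grow k (ℕₚ.<⇒≤ k<2T)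
      ... | inj₂ u = inj₂ u
      ... | inj₁ l with extend (ℕₚ.<⇒≤ k<2T) l
      ...   | inj₁ rigid = inj₂ (rigid⇒unbalanced (ℕₚ.<⇒≤ k<2T) l rigid)
      ...   | inj₂ l′    = inj₁ l′

      unbalanced : Unbalanced
      unbalanced with grow (2 * T) ≤-refl
      ... | inj₁ l = full⇒unbalanced l
      ... | inj₂ u = u

-- Hamilton cycles from lists of vertices

cyclicSuc-inject₁ : ∀ {m} (i : Fin m) → cyclicSuc (inject₁ i) ≡ suc i
cyclicSuc-inject₁ {m} i = Finₚ.toℕ-injective (trans (Finₚ.toℕ-fromℕ< _)
  (trans (cong (λ k → suc k % suc m) (Finₚ.toℕ-inject₁ i)) (m<n⇒m%n≡m (s≤s (Finₚ.toℕ<n i)))))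

cyclicSuc-fromℕ : ∀ m → cyclicSuc (Fin.fromℕ m) ≡ zero
cyclicSuc-fromℕ m = Finₚ.toℕ-injective (trans (Finₚ.toℕ-fromℕ< _)
  (trans (cong (λ k → suc k % suc m) (Finₚ.toℕ-fromℕ m)) (n%n≡0 (suc m))))

cyclicSuc-cast : ∀ {m n} (eq : m ≡ n) i → cast eq (cyclicSuc i) ≡ cyclicSuc (cast eq i)
cyclicSuc-cast refl i = trans (Finₚ.cast-is-id refl _) (cong cyclicSuc (sym (Finₚ.cast-is-id refl i)))

tabulate-cast : ∀ {A : Set} {m n} (eq : m ≡ n) (φ : Fin n → A) →
                tabulate (φ ∘ cast eq) ≡ tabulate φ
tabulate-cast refl φ = tabulate-cong (λ i → cong φ (Finₚ.cast-is-id refl i))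

-- Position `i` numbers the edges of the walk: `lookup (x ∷ R) i` is the near end of an edge and
-- `next x R y i` its far end.
next : {V : Set} (x : V) (R : List V) (y : V) → Fin (suc (length R)) → V
next x []      y zero    = y
next x (z ∷ R) y zero    = z
next x (z ∷ R) y (suc i) = next z R y i

next-inject₁ : ∀ {V : Set} (x : V) R y i → next x R y (inject₁ i) ≡ lookup R i
next-inject₁ x (z ∷ R) y zero    = refl
next-inject₁ x (z ∷ R) y (suc i) = next-inject₁ z R y i

next-fromℕ : ∀ {V : Set} (x : V) R y → next x R y (Fin.fromℕ (length R)) ≡ y
next-fromℕ x []      y = refl
next-fromℕ x (z ∷ R) y = next-fromℕ z R y

next-cyclic : ∀ {V : Set} (x : V) R i → next x R x i ≡ lookup (x ∷ R) (cyclicSuc i)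
next-cyclic x R i with view i
... | ‵fromℕ     = trans (next-fromℕ x R x) (sym (cong (lookup (x ∷ R)) (cyclicSuc-fromℕ (length R))))
... | ‵inject₁ j = trans (next-inject₁ x R x j) (sym (cong (lookup (x ∷ R)) (cyclicSuc-inject₁ j)))

lookup-allFin : ∀ n j → lookup (allFin n) j ≡ cast (length-tabulate {n = n} id) j
lookup-allFin n j = trans
  (cong (lookup (allFin n)) (sym (Finₚ.cast-involutive (sym (length-tabulate {n = n} id)) (length-tabulate {n = n} id) j)))
  (lookup-tabulate id (cast (length-tabulate {n = n} id) j))

module _ {n : ℕ} (C : List (Fin n)) (C↭ : C ↭ allFin n) where

  length-spanning : length C ≡ n
  length-spanning = trans (↭-length C↭) (length-tabulate id)

  -- The permutation `C↭` sends a position in `C` to a position in `allFin n`, which is the vertex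
  -- itself.
  enumeration : Permutation′ n
  enumeration = cast-id (sym length-spanning) ∘ₚ (onIndices (↭⇒↭ₛ C↭) ∘ₚ cast-id (length-tabulate id))

  enumeration-lookup : ∀ i → enumeration ⟨$⟩ʳ i ≡ lookup C (cast (sym length-spanning) i)
  enumeration-lookup i = sym (trans (onIndices-lookup (setoid (Fin n)) (↭⇒↭ₛ C↭) i′)
    (lookup-allFin n (onIndices (↭⇒↭ₛ C↭) ⟨$⟩ʳ i′)))
    where i′ = cast (sym length-spanning) i

large-imbalance : ∀ a b {n T} → a + b ≡ n → 2 * a + T ≤ n → T ≤ ℤ.∣ a ⊖ b ∣
large-imbalance a b {T = T} refl le =
  subst (T ≤_) (sym (ℤₚ.∣⊖∣-≤ (ℕₚ.m+n≤o⇒n≤o T T+a≤b))) (ℕₚ.m+n≤o⇒m≤o∸n T T+a≤b)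
  where
  T+a≤b : T + a ≤ b
  T+a≤b = linear (a ∷ b ∷ T ∷ []) (λ { (a ∷ b ∷ T ∷ []) → 2 ⊛ a ⊕ T ≼ a ⊕ b ⇒ T ⊕ a ≼ b }) le

-- The given graph as a labelled graph

module _ {n : ℕ} (G : Graph n) (f : Labeling G) where
  open Graph G

  edge-irrelevant : ∀ {u v} (p q : u ~ v) → edge G p ≡ edge G q
  edge-irrelevant {u} {v} p q with Finₚ.<-cmp u v
  ... | tri< _ _   _ = refl
  ... | tri≈ _ u≡v _ = ⊥-elim (~-irrefl u≡v p)
  ... | tri> _ _   _ = refl

  edge-sym : ∀ {u v} (p : u ~ v) (q : v ~ u) → edge G p ≡ edge G q
  edge-sym {u} {v} p q with Finₚ.<-cmp u v | Finₚ.<-cmp v u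
  ... | tri< _ _ _     | tri> _ _ _     = refl
  ... | tri> _ _ _     | tri< _ _ _     = refl
  ... | tri≈ _ u≡v _   | _              = ⊥-elim (~-irrefl u≡v p)
  ... | _              | tri≈ _ v≡u _   = ⊥-elim (~-irrefl v≡u q)
  ... | tri< u<v _ _   | tri< _ _ u≮v   = ⊥-elim (u≮v u<v)
  ... | tri> _ _ v<u   | tri> v≮u _ _   = ⊥-elim (v≮u v<u)

  -- Labels of pairs do not depend on adjacency proofs. The constant default keeps the function
  -- symmetric, and walks read it on edges only.
  label : Fin n → Fin n → Sign
  label u v with u ~? v
  ... | yes u~v = f (edge G u~v)
  ... | no  _   = Sign.+

  label-edge : ∀ {u v} (p : u ~ v) → f (edge G p) ≡ label u v
  label-edge {u} {v} p with u ~? v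
  ... | yes q  = cong f (edge-irrelevant p q)
  ... | no  ≁  = contradiction p ≁

  label-sym : ∀ u v → label u v ≡ label v u
  label-sym u v with u ~? v | v ~? u
  ... | yes p | yes q = cong f (edge-sym p q)
  ... | yes p | no  ≁ = contradiction (~-sym p) ≁
  ... | no  ≁ | yes q = contradiction (~-sym q) ≁
  ... | no  _ | no  _ = refl

  open LabelledGraph _~_ _~?_ ~-sym ~-irrefl label label-sym

  Walk-next : ∀ {x} R {y} → Walk x R y → ∀ i → lookup (x ∷ R) i ~ next x R y i
  Walk-next []      x~y       zero    = x~y
  Walk-next (z ∷ R) (x~z , w) zero    = x~z
  Walk-next (z ∷ R) (x~z , w) (suc i) = Walk-next R w i

  signed-⊖ : ∀ σ a b → (σ ◃ 1) ℤ.+ (a ⊖ b) ≡ (weight Sign.+ σ + a) ⊖ (weight Sign.- σ + b)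
  signed-⊖ Sign.+ a b = ℤₚ.distribʳ-⊖-+-pos 1 a b
  signed-⊖ Sign.- a b = ℤₚ.distribʳ-⊖-+-neg 0 a b

  sum-signs : ∀ x R y →
    foldr ℤ._+_ (+ 0) (tabulate λ i → label (lookup (x ∷ R) i) (next x R y i) ◃ 1) ≡
    count Sign.+ x R y ⊖ count Sign.- x R y
  sum-signs x []      y with label x y
  ... | Sign.+ = refl
  ... | Sign.- = refl
  sum-signs x (z ∷ R) y = trans
    (cong (λ k → (label x z ◃ 1) ℤ.+ k) (sum-signs z R y)) (signed-⊖ (label x z) _ _)

  module _ {x R} (spans : x ∷ R ↭ allFin n) (cycle : Walk x R x) (3≤n : 3 ≤ n) where

    private
      position : Fin n → Fin (suc (length R))
      position = cast (sym (length-spanning (x ∷ R) spans))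

      vertexAt : ∀ i → enumeration (x ∷ R) spans ⟨$⟩ʳ i ≡ lookup (x ∷ R) (position i)
      vertexAt = enumeration-lookup (x ∷ R) spans

      vertexAfter : ∀ i → enumeration (x ∷ R) spans ⟨$⟩ʳ cyclicSuc i ≡ next x R x (position i)
      vertexAfter i = trans (vertexAt (cyclicSuc i)) (trans
        (cong (lookup (x ∷ R)) (cyclicSuc-cast (sym (length-spanning (x ∷ R) spans)) i))
        (sym (next-cyclic x R (position i))))

    hamiltonCycle : HamiltonCycle G
    hamiltonCycle = record
      { 3≤n         = 3≤n
      ; vertex      = enumeration (x ∷ R) spans
      ; consecutive = λ i → subst₂ _~_ (sym (vertexAt i)) (sym (vertexAfter i)) (Walk-next R cycle (position i))
      }

    labelSum-cycle : labelSum G f (hamiltonEdges G hamiltonCycle) ≡ count Sign.+ x R x ⊖ count Sign.- x R x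
    labelSum-cycle = begin
      foldr ℤ._+_ (+ 0) (map value (map e (allFin n)))
        ≡⟨ cong (foldr ℤ._+_ (+ 0)) (trans (sym (map-∘ (allFin n))) (map-tabulate id (value ∘ e))) ⟩
      foldr ℤ._+_ (+ 0) (tabulate (value ∘ e))
        ≡⟨ cong (foldr ℤ._+_ (+ 0)) (tabulate-cong λ i → cong (_◃ 1)
             (trans (label-edge (consecutive i)) (cong₂ label (vertexAt i) (vertexAfter i)))) ⟩
      foldr ℤ._+_ (+ 0) (tabulate (step ∘ position))
        ≡⟨ cong (foldr ℤ._+_ (+ 0)) (tabulate-cast (sym (length-spanning (x ∷ R) spans)) step) ⟩
      foldr ℤ._+_ (+ 0) (tabulate step)
        ≡⟨ sum-signs x R x ⟩
      count Sign.+ x R x ⊖ count Sign.- x R x ∎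
      where
      open ≡-Reasoning
      open HamiltonCycle hamiltonCycle using (consecutive)
      value : Edge G → ℤ
      value e = f e ◃ 1
      e : Fin n → Edge G
      e i = edge G (consecutive i)
      step : Fin (suc (length R)) → ℤ
      step i = label (lookup (x ∷ R) i) (next x R x i) ◃ 1

  misses+degree : ∀ a {k} (g : Fin k → Fin n) →
                  misses a (tabulate g) + ∣ Vec.tabulate (λ i → does (a ~? g i)) ∣ ≡ k
  misses+degree a {zero}  g = refl
  misses+degree a {suc k} g with does (a ~? g zero)
  ... | true  = trans (ℕₚ.+-suc _ _) (cong suc (misses+degree a (g ∘ suc)))
  ... | false = cong suc (misses+degree a (g ∘ suc))

  minDegree≤ : ∀ v → minDegree G ≤ degree G v
  minDegree≤ v = All.lookup (min≤xs n (map (degree G) (allFin n))) (∈-map⁺ (degree G) (∈-allFin v))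

  minDegree≤n : minDegree G ≤ n
  minDegree≤n = min≤⊤ n (map (degree G) (allFin n))

  unbalancedCycle : ∀ T → 1 ≤ T → 3 * n + 64 * T ≤ 4 * minDegree G →
                    ∃[ H ] T ≤ ℤ.∣ labelSum G f (hamiltonEdges G H) ∣
  unbalancedCycle T 1≤T dense =
    hamiltonCycle spans cycle 3≤n ,
    subst (λ z → T ≤ ℤ.∣ z ∣) (sym (labelSum-cycle spans cycle 3≤n)) (imbalance rare few)
    where
    q : ℕ
    q = n ∸ minDegree G

    open Dense q

    q+δ : q + minDegree G ≡ n
    q+δ = ℕₚ.m∸n+n≡m minDegree≤n

    sp : Sparse (allFin n)
    sp = sparse λ a → ℕₚ.m+n≤o⇒m≤o∸n (misses a (allFin n))
      (≤-trans (+-monoʳ-≤ (misses a (allFin n)) (minDegree≤ a)) (≤-reflexive (misses+degree a id)))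

    -- With q = n - δ this is the hypothesis `dense` rewritten.
    large : 4 * q + 64 * T ≤ length (allFin n)
    large = subst (4 * q + 64 * T ≤_) (sym (length-tabulate {n = n} id))
      (linear (q ∷ minDegree G ∷ n ∷ T ∷ [])
        (λ { (q ∷ δ ∷ n ∷ T ∷ []) →
          (3 ⊛ n ⊕ 64 ⊛ T) ⊕ 4 ⊛ (q ⊕ δ) ≼ 4 ⊛ δ ⊕ 4 ⊛ n ⇒ 4 ⊛ q ⊕ 64 ⊛ T ≼ n })
        (dense ⊞ 4 ⊡ ≤-reflexive q+δ))

    -- Indeed 64 ≤ 64T ≤ 4δ - 3n ≤ n.
    3≤n : 3 ≤ n
    3≤n = linear (minDegree G ∷ n ∷ T ∷ [])
      (λ { (δ ∷ n ∷ T ∷ []) →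
        64 ⊛ # 1 ⊕ ((3 ⊛ n ⊕ 64 ⊛ T) ⊕ 4 ⊛ δ) ≼ 64 ⊛ T ⊕ (4 ⊛ δ ⊕ 4 ⊛ n) ⇒ # 3 ≼ n })
      (64 ⊡ 1≤T ⊞ dense ⊞ 4 ⊡ minDegree≤n)

    open Unbalanced (unbalanced (allFin n) sp T 1≤T large)

    total : ∀ σ → count σ start interior start + count (opposite σ) start interior start ≡ n
    total σ = trans (count-opposite σ start interior start) (length-spanning _ spans)

    imbalance : ∀ σ → 2 * count σ start interior start + T ≤ length (allFin n) →
                T ≤ ℤ.∣ count Sign.+ start interior start ⊖ count Sign.- start interior start ∣
    imbalance Sign.+ few = large-imbalance (count Sign.+ start interior start) (count Sign.- start interior start) (total Sign.+) (≤-trans few (≤-reflexive (length-tabulate {n = n} id)))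
    imbalance Sign.- few = subst (T ≤_) (ℤₚ.∣m⊖n∣≡∣n⊖m∣ (count Sign.- start interior start) _)
      (large-imbalance (count Sign.- start interior start) (count Sign.+ start interior start) (total Sign.-) (≤-trans few (≤-reflexive (length-tabulate {n = n} id))))

-- Rational estimates

ι : ℕ → ℚ
ι k = + k / 1

-- Since `_/_` cancels common factors, it does not compute on variables; identities about `ι` are
-- transferred from unnormalised rationals.
toℚᵘ-/ : ∀ i d .{{_ : ℕ.NonZero d}} → toℚᵘ (i / d) ℚᵘ.≃ (i ℚᵘ./ d)
toℚᵘ-/ i (suc d) = ℚₚ.toℚᵘ-fromℚᵘ (mkℚᵘ i d)

ι-mono : ∀ {m n} → m ≤ n → ι m ℚ.≤ ι n
ι-mono {m} {n} m≤n = ℚₚ.toℚᵘ-cancel-≤ (ℚᵘₚ.≤-respʳ-≃ (ℚᵘₚ.≃-sym (toℚᵘ-/ (+ n) 1))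
  (ℚᵘₚ.≤-respˡ-≃ (ℚᵘₚ.≃-sym (toℚᵘ-/ (+ m) 1)) (ℚᵘ.*≤* (ℤₚ.*-monoʳ-≤-nonNeg (+ 1) (ℤ.+≤+ m≤n)))))

ι-cancel : ∀ {m n} → ι m ℚ.≤ ι n → m ≤ n
ι-cancel {m} {n} ιm≤ιn with ℚᵘₚ.≤-respʳ-≃ (toℚᵘ-/ (+ n) 1)
  (ℚᵘₚ.≤-respˡ-≃ (toℚᵘ-/ (+ m) 1) (ℚₚ.toℚᵘ-mono-≤ ιm≤ιn))
... | ℚᵘ.*≤* le = ℤₚ.drop‿+≤+ (ℤₚ.*-cancelʳ-≤-pos (+ m) (+ n) (+ 1) le)

ι-+ : ∀ m n → ι (m + n) ≡ ι m ℚ.+ ι n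
ι-+ m n = ℚₚ.toℚᵘ-injective (begin
  toℚᵘ (ι (m + n))                     ≈⟨ toℚᵘ-/ (+ (m + n)) 1 ⟩
  mkℚᵘ (+ (m + n)) 0                   ≈⟨ ℚᵘ.*≡* (cong (ℤ._* + 1) (sym (cong₂ ℤ._+_ (ℤₚ.*-identityʳ (+ m)) (ℤₚ.*-identityʳ (+ n))))) ⟩
  mkℚᵘ (+ m) 0 ℚᵘ.+ mkℚᵘ (+ n) 0       ≈⟨ ℚᵘₚ.+-cong (toℚᵘ-/ (+ m) 1) (toℚᵘ-/ (+ n) 1) ⟨
  toℚᵘ (ι m) ℚᵘ.+ toℚᵘ (ι n)           ≈⟨ ℚₚ.toℚᵘ-homo-+ (ι m) (ι n) ⟨
  toℚᵘ (ι m ℚ.+ ι n)                   ∎)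
  where open ℚᵘₚ.≃-Reasoning

ι-* : ∀ m n → ι (m * n) ≡ ι m ℚ.* ι n
ι-* m n = ℚₚ.toℚᵘ-injective (begin
  toℚᵘ (ι (m * n))                     ≈⟨ toℚᵘ-/ (+ (m * n)) 1 ⟩
  mkℚᵘ (+ (m * n)) 0                   ≈⟨ ℚᵘ.*≡* (cong (ℤ._* + 1) (ℤₚ.pos-* m n)) ⟩
  mkℚᵘ (+ m) 0 ℚᵘ.* mkℚᵘ (+ n) 0       ≈⟨ ℚᵘₚ.*-cong (toℚᵘ-/ (+ m) 1) (toℚᵘ-/ (+ n) 1) ⟨
  toℚᵘ (ι m) ℚᵘ.* toℚᵘ (ι n)           ≈⟨ ℚₚ.toℚᵘ-homo-* (ι m) (ι n) ⟨
  toℚᵘ (ι m ℚ.* ι n)                   ∎)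
  where open ℚᵘₚ.≃-Reasoning

n/32 : ∀ n → + n / 32 ≡ (+ 1 / 32) ℚ.* ι n
n/32 n = ℚₚ.toℚᵘ-injective (begin
  toℚᵘ (+ n / 32)                      ≈⟨ toℚᵘ-/ (+ n) 32 ⟩
  mkℚᵘ (+ n) 31                        ≈⟨ ℚᵘ.*≡* (cong (ℤ._* + 32) (sym (ℤₚ.*-identityˡ (+ n)))) ⟩
  mkℚᵘ (+ 1) 31 ℚᵘ.* mkℚᵘ (+ n) 0      ≈⟨ ℚᵘₚ.*-congˡ (toℚᵘ-/ (+ n) 1) ⟨
  toℚᵘ (+ 1 / 32) ℚᵘ.* toℚᵘ (ι n)      ≈⟨ ℚₚ.toℚᵘ-homo-* (+ 1 / 32) (ι n) ⟨
  toℚᵘ ((+ 1 / 32) ℚ.* ι n)            ∎)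
  where open ℚᵘₚ.≃-Reasoning

1≤denominator* : ∀ ε → 0ℚ ℚ.< ε → 1ℚ ℚ.≤ ι (ℚ.denominatorℕ ε) ℚ.* ε
1≤denominator* ε@(mkℚ (+ zero) d _)   0<ε = contradiction (ℚ.positive 0<ε) λ { () }
1≤denominator* ε@(mkℚ ℤ.-[1+ _ ] d _) 0<ε = contradiction (ℚ.positive 0<ε) λ { () }
1≤denominator* ε@(mkℚ (+ suc p) d _)  0<ε = ℚₚ.toℚᵘ-cancel-≤ (begin
  mkℚᵘ (+ 1) 0                                ≤⟨ ℚᵘ.*≤* (ℤ.+≤+ cross) ⟩
  mkℚᵘ (+ suc d) 0 ℚᵘ.* mkℚᵘ (+ suc p) d      ≃⟨ ℚᵘₚ.*-congʳ (toℚᵘ-/ (+ suc d) 1) ⟨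
  toℚᵘ (ι (suc d)) ℚᵘ.* toℚᵘ ε                ≃⟨ ℚₚ.toℚᵘ-homo-* (ι (suc d)) ε ⟨
  toℚᵘ (ι (suc d) ℚ.* ε)                      ∎)
  where
  open ℚᵘₚ.≤-Reasoning
  cross : 1 * suc (d + 0) ≤ suc d * suc p * 1
  cross = subst₂ _≤_ (sym (trans (ℕₚ.*-identityˡ _) (cong suc (ℕₚ.+-identityʳ d)))) (sym (ℕₚ.*-identityʳ _))
    (ℕₚ.m≤m*n (suc d) (suc p))

-- In the next two lemmas N is the order of the graph, δ its minimum degree,
-- x an approximation of c, and T the discrepancy to be reached.
dense-bound : ∀ (N x δ : ℚ) → N ℚ.* (+ 3 / 4 ℚ.+ x) ℚ.≤ δ ℚ.+ 1ℚ → ι 33 ℚ.≤ N ℚ.* x →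
              ι 3 ℚ.* N ℚ.+ ι 128 ℚ.≤ ι 4 ℚ.* δ
dense-bound N x δ dense big = begin
  ι 3 ℚ.* N ℚ.+ ι 128
    -- The constant 33 is 32 + 1: the 32 yields 128, and the 1 pays for the tolerance in the degree
    -- condition.
    ≡⟨ solve 1 (λ N → con (ι 3) :* N :+ con (ι 128) :=
         con (ι 4) :* (N :* con (+ 3 / 4) :+ con (ι 33)) :- con (ι 4)) refl N ⟩
  ι 4 ℚ.* (N ℚ.* (+ 3 / 4) ℚ.+ ι 33) ℚ.- ι 4
    ≤⟨ ℚₚ.+-monoˡ-≤ (ℚ.- ι 4) (ℚₚ.*-monoˡ-≤-nonNeg (ι 4) (ℚₚ.+-monoʳ-≤ (N ℚ.* (+ 3 / 4)) big)) ⟩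
  ι 4 ℚ.* (N ℚ.* (+ 3 / 4) ℚ.+ N ℚ.* x) ℚ.- ι 4
    ≡⟨ cong (λ k → ι 4 ℚ.* k ℚ.- ι 4) (sym (ℚₚ.*-distribˡ-+ N (+ 3 / 4) x)) ⟩
  ι 4 ℚ.* (N ℚ.* (+ 3 / 4 ℚ.+ x)) ℚ.- ι 4
    ≤⟨ ℚₚ.+-monoˡ-≤ (ℚ.- ι 4) (ℚₚ.*-monoˡ-≤-nonNeg (ι 4) dense) ⟩
  ι 4 ℚ.* (δ ℚ.+ 1ℚ) ℚ.- ι 4
    ≡⟨ solve 1 (λ δ → con (ι 4) :* (δ :+ con 1ℚ) :- con (ι 4) := con (ι 4) :* δ) refl δ ⟩
  ι 4 ℚ.* δ ∎
  where
  open ℚₚ.≤-Reasoning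
  open ℚ-Solver

discrepancy-bound : ∀ (N x δ T ε : ℚ) → 0ℚ ℚ.≤ ε → N ℚ.* (+ 3 / 4 ℚ.+ x) ℚ.≤ δ ℚ.+ ε →
                    ι 4 ℚ.* δ ℚ.≤ ι 3 ℚ.* N ℚ.+ ι 128 ℚ.* T →
                    ((+ 1 / 32) ℚ.* N) ℚ.* x ℚ.≤ T ℚ.+ ε
discrepancy-bound N x δ T ε 0≤ε dense target = begin
  ((+ 1 / 32) ℚ.* N) ℚ.* x
    -- In short, cn/32 ≤ (δ - 3n/4)/32 = (4δ - 3n)/128 ≤ T, up to the tolerance.
    ≡⟨ solve 2 (λ N x → (con (+ 1 / 32) :* N) :* x :=
         con (+ 1 / 32) :* (N :* (con (+ 3 / 4) :+ x)) :- con (+ 3 / 128) :* N) refl N x ⟩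
  (+ 1 / 32) ℚ.* (N ℚ.* (+ 3 / 4 ℚ.+ x)) ℚ.- (+ 3 / 128) ℚ.* N
    ≤⟨ ℚₚ.+-monoˡ-≤ (ℚ.- ((+ 3 / 128) ℚ.* N)) (ℚₚ.*-monoˡ-≤-nonNeg (+ 1 / 32) dense) ⟩
  (+ 1 / 32) ℚ.* (δ ℚ.+ ε) ℚ.- (+ 3 / 128) ℚ.* N
    ≡⟨ solve 3 (λ N δ ε → con (+ 1 / 32) :* (δ :+ ε) :- con (+ 3 / 128) :* N :=
         con (+ 1 / 128) :* (con (ι 4) :* δ) :+ (con (+ 1 / 32) :* ε :- con (+ 3 / 128) :* N)) refl N δ ε ⟩
  (+ 1 / 128) ℚ.* (ι 4 ℚ.* δ) ℚ.+ ((+ 1 / 32) ℚ.* ε ℚ.- (+ 3 / 128) ℚ.* N)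
    ≤⟨ ℚₚ.+-monoˡ-≤ ((+ 1 / 32) ℚ.* ε ℚ.- (+ 3 / 128) ℚ.* N) (ℚₚ.*-monoˡ-≤-nonNeg (+ 1 / 128) target) ⟩
  (+ 1 / 128) ℚ.* (ι 3 ℚ.* N ℚ.+ ι 128 ℚ.* T) ℚ.+ ((+ 1 / 32) ℚ.* ε ℚ.- (+ 3 / 128) ℚ.* N)
    ≡⟨ solve 3 (λ N T ε → con (+ 1 / 128) :* (con (ι 3) :* N :+ con (ι 128) :* T) :+
                          (con (+ 1 / 32) :* ε :- con (+ 3 / 128) :* N) :=
         T :+ (con (+ 1 / 32) :* ε :+ con 0ℚ)) refl N T ε ⟩
  T ℚ.+ ((+ 1 / 32) ℚ.* ε ℚ.+ 0ℚ)
    ≤⟨ ℚₚ.+-monoʳ-≤ T (ℚₚ.+-monoʳ-≤ ((+ 1 / 32) ℚ.* ε) 0≤31ε/32) ⟩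
  T ℚ.+ ((+ 1 / 32) ℚ.* ε ℚ.+ (+ 31 / 32) ℚ.* ε)
    ≡⟨ solve 2 (λ T ε → T :+ (con (+ 1 / 32) :* ε :+ con (+ 31 / 32) :* ε) := T :+ ε) refl T ε ⟩
  T ℚ.+ ε ∎
  where
  open ℚₚ.≤-Reasoning
  open ℚ-Solver
  0≤31ε/32 : 0ℚ ℚ.≤ (+ 31 / 32) ℚ.* ε
  0≤31ε/32 = subst (ℚ._≤ (+ 31 / 32) ℚ.* ε) (ℚₚ.*-zeroʳ (+ 31 / 32)) (ℚₚ.*-monoˡ-≤-nonNeg (+ 31 / 32) 0≤ε)

-- Taking `T` from the integer 4δ - 3n instead of from c avoids rounding a real number.
target-exists : ∀ n δ → 3 * n + 128 ≤ 4 * δ →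
                ∃[ T ] 1 ≤ T × 3 * n + 64 * T ≤ 4 * δ × 4 * δ ≤ 3 * n + 128 * T
target-exists n δ dense = T , m≥n⇒m/n>0 (≤-trans (ℕₚ.m≤m+n 64 64) 128≤D) , lower , upper
  where
  D T r : ℕ
  D = 4 * δ ∸ 3 * n
  T = D /ₙ 64
  r = D % 64

  3n+D : 3 * n + D ≡ 4 * δ
  3n+D = ℕₚ.m+[n∸m]≡n (ℕₚ.m+n≤o⇒m≤o (3 * n) dense)

  D≡ : D ≡ r + T * 64
  D≡ = m≡m%n+[m/n]*n D 64

  128≤D : 128 ≤ D
  128≤D = ℕₚ.+-cancelˡ-≤ (3 * n) _ _ (≤-trans dense (≤-reflexive (sym 3n+D)))

  64T : T * 64 ≡ 64 * T
  64T = ℕₚ.*-comm T 64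

  lower : 3 * n + 64 * T ≤ 4 * δ
  lower = linear (n ∷ T ∷ r ∷ D ∷ δ ∷ [])
    (λ { (n ∷ T ∷ r ∷ D ∷ δ ∷ []) →
      (r ⊕ 64 ⊛ T) ⊕ (3 ⊛ n ⊕ D) ≼ D ⊕ 4 ⊛ δ ⇒ 3 ⊛ n ⊕ 64 ⊛ T ≼ 4 ⊛ δ })
    (≤-reflexive (sym (trans D≡ (cong (_+_ r) 64T))) ⊞ ≤-reflexive 3n+D)

  upper : 4 * δ ≤ 3 * n + 128 * T
  -- With r ≤ 63 and D ≥ 128, D = 2D - D ≤ 128T + 126 - 128.
  upper = linear (n ∷ T ∷ r ∷ D ∷ δ ∷ [])
    (λ { (n ∷ T ∷ r ∷ D ∷ δ ∷ []) →
      4 ⊛ δ ⊕ (2 ⊛ D ⊕ (# 128 ⊕ 2 ⊛ (# 1 ⊕ r))) ≼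
      (3 ⊛ n ⊕ D) ⊕ (2 ⊛ (r ⊕ 64 ⊛ T) ⊕ (D ⊕ 2 ⊛ # 64)) ⇒ 4 ⊛ δ ≼ 3 ⊛ n ⊕ 128 ⊛ T })
    (≤-reflexive (sym 3n+D) ⊞ 2 ⊡ ≤-reflexive (trans D≡ (cong (_+_ r) 64T)) ⊞ 128≤D ⊞ 2 ⊡ m%n<n D 64)

theorem1p1 : ∀ (c : ℝ) → fromℚ 0ℚ <ℝ c →
    ∃[ n₀ ] ∀ (n : ℕ) → n₀ ≤ n → (G : Graph n) →
    (+ n / 1) *ₗ (fromℚ (+ 3 / 4) +ℝ c) ≤ℝ fromℕ (minDegree G) →
    Discrepancy≥ G (hamiltonEdges G) ((+ n / 32) *ₗ c)
-- Beyond n₀ we have n ε₀ ≥ 33, hence 4δ − 3n ≥ 128, so that rounding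
-- (4δ − 3n)/64 down still leaves at least (4δ − 3n)/128.
theorem1p1 c (ε₀ , 0<ε₀ , N₀ , c≥ε₀) = 33 * ℚ.denominatorℕ ε₀ , λ n n₀≤n G dense f →
  -- Tolerance 1 at a single index `m` fixes `T`, which depends on n and δ only. The degree
  -- condition is used again below, with arbitrary `ε`, for the comparison with c.
  let N₁ , dense₁ = dense 1ℚ (ℚₚ.positive⁻¹ 1ℚ)
      m = N₀ ℕ.⊔ N₁
      T , 1≤T , lower , upper = target-exists n (minDegree G) (many-edges n (minDegree G) (seq c m)
        (dense₁ m (ℕₚ.m≤n⊔m N₀ N₁))
        (ℚₚ.≤-trans (large n n₀≤n) (ℚₚ.*-monoˡ-≤-nonNeg (ι n) {{ι-nonNegative n}} (c-lower m (ℕₚ.m≤m⊔n N₀ N₁)))))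
      H , T≤ = unbalancedCycle G f T 1≤T lower
  in H , λ ε 0<ε → let N , dense-ε = dense ε 0<ε in N , λ k N≤k →
    ℚₚ.≤-trans (final n (minDegree G) T (seq c k) ε 0<ε (dense-ε k N≤k) upper)
               (ℚₚ.+-monoˡ-≤ ε (ι-mono T≤))
  where
  c-lower : ∀ m → N₀ ≤ m → ε₀ ℚ.≤ seq c m
  c-lower m N₀≤m = subst (ℚ._≤ seq c m) (ℚₚ.+-identityˡ ε₀) (c≥ε₀ m N₀≤m)

  ι-nonNegative : ∀ n → ℚ.NonNegative (ι n)
  ι-nonNegative n = ℚ.nonNegative (ι-mono {0} {n} z≤n)

  large : ∀ n → 33 * ℚ.denominatorℕ ε₀ ≤ n → ι 33 ℚ.≤ ι n ℚ.* ε₀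
  large n n₀≤n = begin
    ι 33                                      ≡⟨ ℚₚ.*-identityʳ (ι 33) ⟨
    ι 33 ℚ.* 1ℚ                               ≤⟨ ℚₚ.*-monoˡ-≤-nonNeg (ι 33) (1≤denominator* ε₀ 0<ε₀) ⟩
    ι 33 ℚ.* (ι (ℚ.denominatorℕ ε₀) ℚ.* ε₀)   ≡⟨ ℚₚ.*-assoc (ι 33) (ι (ℚ.denominatorℕ ε₀)) ε₀ ⟨
    ι 33 ℚ.* ι (ℚ.denominatorℕ ε₀) ℚ.* ε₀     ≡⟨ cong (ℚ._* ε₀) (ι-* 33 (ℚ.denominatorℕ ε₀)) ⟨
    ι (33 * ℚ.denominatorℕ ε₀) ℚ.* ε₀         ≤⟨ ℚₚ.*-monoʳ-≤-nonNeg ε₀ {{ℚ.nonNegative (ℚₚ.<⇒≤ 0<ε₀)}} (ι-mono n₀≤n) ⟩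
    ι n ℚ.* ε₀                                ∎
    where open ℚₚ.≤-Reasoning

  many-edges : ∀ n δ x → ι n ℚ.* (+ 3 / 4 ℚ.+ x) ℚ.≤ ι δ ℚ.+ 1ℚ → ι 33 ℚ.≤ ι n ℚ.* x →
               3 * n + 128 ≤ 4 * δ
  many-edges n δ x dense big = ι-cancel (subst₂ ℚ._≤_
    (sym (trans (ι-+ (3 * n) 128) (cong (ℚ._+ ι 128) (ι-* 3 n)))) (sym (ι-* 4 δ))
    (dense-bound (ι n) x (ι δ) dense big))

  final : ∀ n δ T x ε → 0ℚ ℚ.< ε → ι n ℚ.* (+ 3 / 4 ℚ.+ x) ℚ.≤ ι δ ℚ.+ ε →
          4 * δ ≤ 3 * n + 128 * T → (+ n / 32) ℚ.* x ℚ.≤ ι T ℚ.+ ε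
  final n δ T x ε 0<ε dense upper =
    subst (λ k → k ℚ.* x ℚ.≤ ι T ℚ.+ ε) (sym (n/32 n))
      (discrepancy-bound (ι n) x (ι δ) (ι T) ε (ℚₚ.<⇒≤ 0<ε) dense
        (subst₂ ℚ._≤_ (ι-* 4 δ) (trans (ι-+ (3 * n) (128 * T)) (cong₂ ℚ._+_ (ι-* 3 n) (ι-* 128 T)))
          (ι-mono upper)))
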